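{- Splitting is a minor-closed property: if a graph $G$ splits and $G_m$ is a minor of $G$, then $G_m$ splits.
   Context: Graphs are finite undirected multigraphs, possibly with loops and parallel edges. A minor of $G$ is a graph obtained from $G$ by a (possibly empty) sequence of edge deletions and edge contractions. Contracting an edge removes it and identifies its ends (parallel edges and loops created are kept). Dodgson polynomials: assign a variable $\alpha_e$ to each edge $e$ of $G$. Orient the edges arbitrarily, let $\xi_G$ be the $|E(G)|\times|V(G)|$ incidence matrix with $(\xi_G)_{e,v}=1$ if $v$ is the source of $e$, $-1$ if $v$ is the target of $e$, and $0$ otherwise (the row of a loop is zero), let $\widehat\xi_G$ be $\xi_G$ with one arbitrary column deleted, and let $A$ be the diagonal matrix with entries $\alpha_e$. Put $$M_G=\begin{pmatrix}A&\widehat\xi_G\\-\widehat\xi_G^{\,T}&0\end{pmatrix}.$$ For $I,J,K\subseteq E(G)$ with $|I|=|J|$, the Dodgson polynomial $\Psi^{I,J}_K$ is the determinant of the matrix obtained from $M_G$ by deleting the rows indexed by $I$, deleting the columns indexed by $J$, and setting $\alpha_e=0$ for all $e\in K$; it is well defined up to sign. A $5$-configuration is a set $S\subseteq E(G)$ with $|S|=5$. $D_S$ is the set of (thirty) Dodgson polynomials $\Psi^{I,J}_K$ with $I\cup J\cup K=S$, $K$ disjoint from $I\cup J$, and either $|I|=|J|=2$, $I\cap J=\emptyset$, $|K|=1$, or $|I|=|J|=3$, $|I\cap J|=1$, $K=\emptyset$. The $5$-configuration $S$ splits if at least one $D\in D_S$ is the zero polynomial; otherwise $S$ is non-splitting.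 A graph $G$ splits if every $5$-configuration $S\subseteq E(G)$ splits. -}

module Defs where

open import Algebra.Bundles.Raw using (RawRing)
import Algebra.Definitions.RawSemiring as RawSemiringDefinitions
open import Data.Bool.Base using (if_then_else_)
open import Data.Fin.Base using (Fin; zero; suc; toℕ; cast; punchIn; punchOut; splitAt)
open import Data.Fin.Permutation using (Permutation′; _⟨$⟩ʳ_)
open import Data.Fin.Properties using (_≟_)
open import Data.Fin.Subset using (Subset; inside; outside; ⊥; ∁; _∩_; _∪_; ∣_∣)
open import Data.Fin.Subset.Properties using (_∈?_; ∣∁p∣≡n∸∣p∣)
open import Data.Integer.Base as ℤ using (ℤ; 0ℤ; 1ℤ; -1ℤ)
open import Data.List.Base as List using (List; []; _∷_)
open import Data.Nat.Base as ℕ using (ℕ; zero; suc; _∸_)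
import Data.Nat.Properties as ℕ
open import Data.Product.Base as Product using (Σ-syntax; _×_; _,_; proj₁; proj₂; swap)
open import Data.Sum.Base as Sum using (_⊎_; inj₁; inj₂)
open import Data.Vec.Base as Vec using (Vec; []; _∷_)
import Data.Vec.Properties as Vec
open import Function.Base using (_∘_)
open import Level using (0ℓ)
open import Relation.Binary.PropositionalEquality
  using (_≡_; _≢_; sym; trans; cong; module ≡-Reasoning)
open import Relation.Nullary using (does; yes; no)

------------------------------------------------------------------------
-- Polynomials over ℤ

-- A monomial is its vector of exponents.

Monomial : ℕ → Set
Monomial = Vec ℕ

-- A finite formal sum of terms.  Terms with equal monomials may be
-- repeated and coefficients may be zero, so polynomials are compared by
-- `_≋_` below and not by `_≡_`.

Poly : ℕ → Set
Poly m = List (ℤ × Monomial m)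

module _ {m : ℕ} where

  coeff : Poly m → Monomial m → ℤ
  coeff []            μ = 0ℤ
  coeff ((a , ν) ∷ p) μ =
    (if does (Vec.≡-dec ℕ._≟_ ν μ) then a else 0ℤ) ℤ.+ coeff p μ

  infix 4 _≋_

  _≋_ : Poly m → Poly m → Set
  p ≋ q = ∀ μ → coeff p μ ≡ coeff q μ

  constant : ℤ → Poly m
  constant a = (a , Vec.replicate m 0) ∷ []

  var : Fin m → Poly m
  var i = (1ℤ , Vec.tabulate λ j → if does (i ≟ j) then 1 else 0) ∷ []

  mulTerm : ℤ × Monomial m → ℤ × Monomial m → ℤ × Monomial m
  mulTerm (a , μ) (b , ν) = a ℤ.* b , Vec.zipWith ℕ._+_ μ ν

polyRing : ℕ → RawRing 0ℓ 0ℓ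
polyRing m = record
  { Carrier = Poly m
  ; _≈_     = _≋_
  ; _+_     = List._++_
  ; _*_     = List.cartesianProductWith mulTerm
  ; -_      = List.map λ (a , μ) → ℤ.- a , μ
  ; 0#      = []
  ; 1#      = constant 1ℤ
  }

------------------------------------------------------------------------
-- Determinants

Matrix : Set → ℕ → Set
Matrix A k = Fin k → Fin k → A

module Determinant (R : RawRing 0ℓ 0ℓ) where
  open RawRing R
  open RawSemiringDefinitions rawSemiring using (sum; _^_)

  -- Laplace expansion along the first row.

  det : ∀ {k} → Matrix Carrier k → Carrier
  det {zero}  M = 1#
  det {suc k} M = sum λ j →
    ((- 1#) ^ toℕ j * M zero j) * det (λ r c → M (suc r) (punchIn j c))

------------------------------------------------------------------------
-- Multigraphs

-- Unordered pairs are represented by ordered ones, compared up to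
-- exchanging the components.

infix 4 _≈ₚ_

_≈ₚ_ : {A : Set} → A × A → A × A → Set
p ≈ₚ q = p ≡ q ⊎ p ≡ swap q

-- `Graph n m` has n vertices and m edges.  The order in which the ends
-- of an edge are stored carries no meaning.

record Graph (n m : ℕ) : Set where
  constructor graph
  field
    ends : Fin m → Fin n × Fin n

open Graph public

IsLoop : ∀ {n m} → Graph n m → Fin m → Set
IsLoop G e = proj₁ (ends G e) ≡ proj₂ (ends G e)

IsLink : ∀ {n m} → Graph n m → Fin m → Set
IsLink G e = proj₁ (ends G e) ≢ proj₂ (ends G e)

record _≅_ {n m} (G H : Graph n m) : Set where
  field
    onVertices : Permutation′ n
    onEdges    : Permutation′ m
    onEnds     : ∀ e → ends H (onEdges ⟨$⟩ʳ e) ≈ₚ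
                       Product.map (onVertices ⟨$⟩ʳ_) (onVertices ⟨$⟩ʳ_) (ends G e)

infixl 6 _∖_

_∖_ : ∀ {n m} → Graph n (suc m) → Fin (suc m) → Graph n m
G ∖ e = graph (ends G ∘ punchIn e)

-- The quotient map identifying v with u: the vertex v is sent to the
-- image of u, and the vertices other than v are renumbered.

identify : ∀ {n} (u v : Fin (suc n)) → u ≢ v → Fin (suc n) → Fin n
identify u v u≢v w with v ≟ w
... | yes _   = punchOut {i = v} {j = u} (u≢v ∘ sym)
... | no  v≢w = punchOut v≢w

contract : ∀ {n m} (G : Graph (suc n) (suc m)) (e : Fin (suc m)) →
           IsLink G e → Graph n m
contract G e u≢v = graph (Product.map q q ∘ ends (G ∖ e))
  where q = identify (proj₁ (ends G e)) (proj₂ (ends G e)) u≢v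

-- H ≼ G: H is a minor of G.  Since deletions and contractions renumber
-- the vertices and edges, the outcome is taken up to isomorphism.
-- The ends of a loop are already identified, so contracting it only
-- removes it.

infix 4 _≼_

data _≼_ {n′ m′} (H : Graph n′ m′) : ∀ {n m} → Graph n m → Set where
  done          : {G : Graph n′ m′} → H ≅ G → H ≼ G
  delete        : ∀ {n m} {G : Graph n (suc m)} (e : Fin (suc m)) →
                  H ≼ G ∖ e → H ≼ G
  contract-link : ∀ {n m} {G : Graph (suc n) (suc m)} (e : Fin (suc m))
                  (link : IsLink G e) → H ≼ contract G e link → H ≼ G
  contract-loop : ∀ {n m} {G : Graph n (suc m)} (e : Fin (suc m)) →
                  IsLoop G e → H ≼ G ∖ e → H ≼ G

------------------------------------------------------------------------
-- The matrix M_G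

record Orientation {n m} (G : Graph n m) : Set where
  field
    source  : Fin m → Fin n
    target  : Fin m → Fin n
    orients : ∀ e → (source e , target e) ≈ₚ ends G e

open Orientation public

incidence : ∀ {n m} {G : Graph n m} → Orientation G → Fin m → Fin n → ℤ
incidence o e v =
  if does (source o e ≟ target o e) then 0ℤ
  else if does (v ≟ source o e)     then 1ℤ
  else if does (v ≟ target o e)     then -1ℤ
  else 0ℤ

-- The arbitrary choices on which M_G depends.

record Choice {n m} (G : Graph n m) : Set where
  field
    orientation : Orientation G
    column      : Fin n

open Choice public

module _ {n m} {G : Graph (suc n) m} (c : Choice G) where
  open RawRing (polyRing m) using (-_; 0#)

  ξ̂ : Fin m → Fin n → Poly m
  ξ̂ e v = constant (incidence (orientation c) e (punchIn (column c) v))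

  -- M_G after setting α_e = 0 for all e ∈ K.

  bigMatrix : Subset m → Fin m ⊎ Fin n → Fin m ⊎ Fin n → Poly m
  bigMatrix K (inj₁ e) (inj₁ f) =
    if does (e ≟ f) then (if does (e ∈? K) then 0# else var e) else 0#
  bigMatrix K (inj₁ e) (inj₂ v) = ξ̂ e v
  bigMatrix K (inj₂ v) (inj₁ e) = - ξ̂ e v
  bigMatrix K (inj₂ v) (inj₂ w) = 0#

------------------------------------------------------------------------
-- Dodgson polynomials

-- The increasing enumeration of the elements of a subset.

enumerate : ∀ {m} (p : Subset m) → Fin ∣ p ∣ → Fin m
enumerate (inside  ∷ p) zero    = zero
enumerate (inside  ∷ p) (suc i) = suc (enumerate p i)
enumerate (outside ∷ p) i       = suc (enumerate p i)

-- The indices of M_G left after deleting those in I.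

remaining : ∀ {n m} (I : Subset m) → Fin (∣ ∁ I ∣ ℕ.+ n) → Fin m ⊎ Fin n
remaining I i = Sum.map₁ (enumerate (∁ I)) (splitAt ∣ ∁ I ∣ i)

∣∁∣-cong : ∀ {m} (I J : Subset m) → ∣ I ∣ ≡ ∣ J ∣ → ∣ ∁ I ∣ ≡ ∣ ∁ J ∣
∣∁∣-cong {m} I J eq = begin
  ∣ ∁ I ∣    ≡⟨ ∣∁p∣≡n∸∣p∣ I ⟩
  m ∸ ∣ I ∣  ≡⟨ cong (m ∸_) eq ⟩
  m ∸ ∣ J ∣  ≡⟨ ∣∁p∣≡n∸∣p∣ J ⟨
  ∣ ∁ J ∣    ∎
  where open ≡-Reasoning

-- Ψ c I J K eq is the polynomial Ψ^{I,J}_K.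

Ψ : ∀ {n m} {G : Graph (suc n) m} → Choice G →
    (I J K : Subset m) → ∣ I ∣ ≡ ∣ J ∣ → Poly m
Ψ {n} {m} c I J K eq = det λ r s →
  bigMatrix c K (remaining I r)
                (remaining J (cast (cong (ℕ._+ n) (∣∁∣-cong I J eq)) s))
  where open Determinant (polyRing m)

------------------------------------------------------------------------
-- Splitting

-- The index triples (I , J , K) of the elements of D_S.  Exchanging I
-- and J changes Ψ^{I,J}_K at most by a sign, so each of the thirty
-- polynomials arises from two triples.

record DodgsonIndex {m} (S : Subset m) : Set where
  field
    I J K    : Subset m
    covers   : I ∪ J ∪ K ≡ S
    disjoint : K ∩ (I ∪ J) ≡ ⊥
    shape    : (∣ I ∣ ≡ 2 × ∣ J ∣ ≡ 2 × I ∩ J ≡ ⊥ × ∣ K ∣ ≡ 1) ⊎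
               (∣ I ∣ ≡ 3 × ∣ J ∣ ≡ 3 × ∣ I ∩ J ∣ ≡ 1 × K ≡ ⊥)

  ∣I∣≡∣J∣ : ∣ I ∣ ≡ ∣ J ∣
  ∣I∣≡∣J∣ with shape
  ... | inj₁ (i , j , _) = trans i (sym j)
  ... | inj₂ (i , j , _) = trans i (sym j)

module _ {n m} {G : Graph (suc n) m} (c : Choice G) where
  open RawRing (polyRing m) using (_≈_; 0#)

  ConfigurationSplits : Subset m → Set
  ConfigurationSplits S =
    Σ[ d ∈ DodgsonIndex S ] let open DodgsonIndex d in Ψ c I J K ∣I∣≡∣J∣ ≈ 0#

  Splits : Set
  Splits = ∀ (S : Subset m) → ∣ S ∣ ≡ 5 → ConfigurationSplits S

{-# OPTIONS --safe #-}
module Submission where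

-- Let e be an edge outside I ∪ J ∪ K.  As a polynomial in α_e, Ψ^{I,J}_K(G)
-- has the coefficient Ψ^{I,J}_K(G ∖ e) of α_e, and its constant term is
-- ± Ψ^{I,J}_K(G / e) when e is a link.  So a vanishing Dodgson polynomial of G
-- gives a vanishing one of every minor that keeps the edges of I ∪ J ∪ K.
-- Vanishing does not depend on the choices made in M_G: permuting, negating
-- and replacing rows and columns changes determinants by a sign only, and
-- the columns of the incidence matrix sum to zero.  A configuration of the
-- minor is one of G, whence the claim.

open import Defs
open import Algebra.Bundles using (CommutativeRing)
open import Algebra.Bundles.Raw using (RawRing)
import Algebra.Solver.CommutativeMonoid as CommutativeMonoidSolver
open import Data.Bool.Base using (Bool; true; false; if_then_else_; _∧_; _∨_)
open import Data.Fin.Base using (Fin; zero; suc; toℕ; cast; join; punchIn; punchOut; splitAt)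
open import Data.Fin.Patterns using (0F; 1F)
open import Data.Fin.Permutation as Perm using (Permutation; Permutation′; _⟨$⟩ʳ_; _⟨$⟩ˡ_)
open import Data.Fin.Properties
  using (_≟_; any?; join-splitAt; punchIn-injective; punchIn-punchOut; punchInᵢ≢i; punchOut-cong;
         punchOut-punchIn; splitAt-join; suc-injective)
open import Data.Fin.Subset using (Subset; inside; outside; ⊥; ∁; _∈_; _∉_; _⊆_; _∩_; _∪_; ∣_∣)
open import Data.Fin.Subset.Properties
  using (_∈?_; p∩q⊆p; p⊆p∪q; q⊆p∪q; x∈∁p⇒x∉p; x∉p⇒x∈∁p; ⊆-antisym)
open import Data.Integer.Base as ℤ using (ℤ; 0ℤ; 1ℤ)
import Data.Integer.Properties as ℤ
open import Algebra.Properties.CommutativeSemigroup ℤ.+-commutativeSemigroup using (x∙yz≈y∙xz)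
open import Data.List.Base as List using ([]; _∷_; _++_)
import Data.List.Properties as List
open import Data.Nat.Base as ℕ using (ℕ; zero; suc)
import Data.Nat.Properties as ℕ
open import Data.Product.Base as Product using (∃; ∃₂; _×_; _,_; proj₁; proj₂)
open import Data.Sum.Base as Sum using (_⊎_; inj₁; inj₂)
open import Data.Sum.Properties using (inj₁-injective; inj₂-injective)
open import Data.Unit.Base using (⊤; tt)
open import Data.Vec.Base as Vec using (here; there; insertAt; lookup; replicate; tabulate; zipWith;
  []; _∷_)
open import Data.Vec.Functional as F using ()
import Data.Vec.Properties as Vec
open import Function.Base using (_∘_; flip; id)
open import Function.Bundles using (mk⇔)
open import Function.Definitions using (Injective)
open import Level using (0ℓ)
open import Relation.Binary.PropositionalEquality as ≡ using (_≡_; _≢_; _≗_)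
open import Relation.Nullary using (does; yes; no; contradiction)
open import Relation.Nullary.Decidable using (dec-false; dec-true; does-⇔; toSum; _×-dec_)


-- Deleting edges and merging vertices renumber the indices, so the submatrices belonging to a graph
-- and to its minor arise in unrelated orders, and every comparison would carry the sign of a
-- permutation. Only vanishing matters, so row and column sets are predicates on `Fin m ⊎ Fin n`,
-- and `Singular` asks for a zero determinant under all enumerations of them. The matrix `L` keeps
-- every column of the incidence matrix; the deleted one is a vertex excluded by the predicate, and
-- is thereby free to be moved. The second obstacle is that a minor has its polynomials in a ring
-- with one variable fewer. The inclusion of rings is injective and commutes with determinants, so
-- vanishing is pulled back along it, and the specialisation `α_e = 0` is never an evaluation: it is
-- a matrix written over the smaller ring whose weight at `e` is zero.

-- Enumerations of predicates, and bijections between predicates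

module Enumerations where
  open ≡ using (refl; sym; trans; cong)

  private variable
    X Y : Set
    P Q : X → Set
    k l : ℕ

  record Enumerates {X : Set} {k} (r : Fin k → X) (P : X → Set) : Set where
    field
      injective : Injective _≡_ _≡_ r
      sound     : ∀ i → P (r i)
      complete  : ∀ {x} → P x → ∃ λ i → r i ≡ x

  open Enumerates public

  infixl 6 _-_

  _-_ : (X → Set) → X → X → Set
  (P - x) y = P y × y ≢ x

  reenumeration : {r : Fin k → X} {s : Fin l → X} → Enumerates r P → Enumerates s P →
    ∃ λ (π : Permutation l k) → ∀ i → r (π ⟨$⟩ʳ i) ≡ s i
  reenumeration {r = r} {s} R S = Perm.permutation to from
    (λ i → injective R (trans (proj₂ (complete R (sound S (from i)))) (proj₂ (complete S (sound R i)))))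
    (λ i → injective S (trans (proj₂ (complete S (sound R (to i)))) (proj₂ (complete R (sound S i)))))
    , λ i → proj₂ (complete R (sound S i))
    where
    to   = λ i → proj₁ (complete R (sound S i))
    from = λ i → proj₁ (complete S (sound R i))

  enumerates-size : {r : Fin k → X} {s : Fin l → X} → Enumerates r P → Enumerates s P → k ≡ l
  enumerates-size R S = sym (Perm.↔⇒≡ (proj₁ (reenumeration R S)))

  enumerates-⇔ : {r : Fin k → X} → (∀ {x} → P x → Q x) → (∀ {x} → Q x → P x) →
    Enumerates r P → Enumerates r Q
  enumerates-⇔ to from R = record
    { injective = injective R ; sound = to ∘ sound R ; complete = complete R ∘ from }

  -- Only equality with `x` has to be decidable, so that `P` itself may be an arbitrary predicate.
  enumerates-cons : {r : Fin k → X} {x : X} → P x → (∀ y → y ≡ x ⊎ y ≢ x) →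
    Enumerates r (P - x) → Enumerates (x F.∷ r) P
  enumerates-cons {X = X} {P = P} {r = r} {x} Px dec R = record
    { injective = λ {i} {j} → inj i j
    ; sound     = λ { zero → Px ; (suc i) → proj₁ (sound R i) }
    ; complete  = comp
    }
    where
    inj : ∀ i j → (x F.∷ r) i ≡ (x F.∷ r) j → i ≡ j
    inj zero    zero    eq = refl
    inj zero    (suc j) eq = contradiction (sym eq) (proj₂ (sound R j))
    inj (suc i) zero    eq = contradiction eq (proj₂ (sound R i))
    inj (suc i) (suc j) eq = cong suc (injective R eq)
    comp : ∀ {y} → P y → ∃ λ i → (x F.∷ r) i ≡ y
    comp {y} Py with dec y
    ... | inj₁ y≡x = zero , sym y≡x
    ... | inj₂ y≢x with complete R (Py , y≢x)
    ...   | i , eq = suc i , eq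

  enumerates-remove : {r : Fin (suc k) → X} (i : Fin (suc k)) → Enumerates r P →
    Enumerates (r ∘ punchIn i) (P - r i)
  enumerates-remove {P = P} {r = r} i R = record
    { injective = punchIn-injective i _ _ ∘ injective R
    ; sound     = λ j → sound R (punchIn i j) , punchInᵢ≢i i j ∘ injective R
    ; complete  = comp
    }
    where
    comp : ∀ {y} → (P - r i) y → ∃ λ j → r (punchIn i j) ≡ y
    comp (Py , y≢ri) with complete R Py
    ... | j , refl = punchOut i≢j , cong r (punchIn-punchOut i≢j)
      where i≢j : i ≢ j
            i≢j refl = y≢ri refl

  -- The size is returned with an equation because `k` belongs to a given enumeration; matching on
  -- the equation exposes it as a successor.
  enumerates-without : {r : Fin k → X} {x : X} → Enumerates r P → P x →
    ∃₂ λ l (s : Fin l → X) → k ≡ suc l × Enumerates s (P - x)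
  enumerates-without {k = zero}  R Px with () ← proj₁ (complete R Px)
  enumerates-without {k = suc k} R Px with complete R Px
  ... | i , refl = k , _ , refl , enumerates-remove i R

  -- A bijection between predicates whose map is injective on all of `X`. In `L-relabel` injectivity
  -- is applied to a row label and a column label, which satisfy different predicates.
  record Onto {X Y : Set} (φ : X → Y) (P′ : X → Set) (P : Y → Set) : Set where
    field
      φ-injective : Injective _≡_ _≡_ φ
      into        : ∀ {x} → P′ x → P (φ x)
      onto        : ∀ {y} → P y → ∃ λ x → P′ x × φ x ≡ y

  open Onto public

  enumerates-image : {φ : X → Y} {r : Fin k → X} → Onto φ P Q → Enumerates r P → Enumerates (φ ∘ r) Q
  enumerates-image {Q = Q} {φ = φ} {r} O R = record
    { injective = injective R ∘ φ-injective O
    ; sound     = into O ∘ sound R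
    ; complete  = comp
    }
    where
    comp : ∀ {y} → Q y → ∃ λ i → φ (r i) ≡ y
    comp Qy with onto O Qy
    ... | x , Px , refl with complete R Px
    ...   | i , refl = i , refl

  enumerates-∘-permutation : {r : Fin k → X} (π : Permutation l k) → Enumerates r P →
    Enumerates (r ∘ (π ⟨$⟩ʳ_)) P
  enumerates-∘-permutation {r = r} π R = record
    { injective = λ eq → trans (sym (Perm.inverseˡ π))
        (trans (cong (Perm._⟨$⟩ˡ_ π) (injective R eq)) (Perm.inverseˡ π))
    ; sound     = λ i → sound R (π ⟨$⟩ʳ i)
    ; complete  = λ Px → let i , eq = complete R Px in
        π Perm.⟨$⟩ˡ i , trans (cong r (Perm.inverseʳ π)) eq
    }

  enumerates-⊎ : ∀ {r : Fin k → X} {s : Fin l → Y} → Enumerates r P → Enumerates s Q →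
    Enumerates (Sum.map r s ∘ splitAt k) Sum.[ P , Q ]
  enumerates-⊎ {k = k} {l = l} {P = P} {Q = Q} {r = r} {s} R S = record
    { injective = λ {i} {j} eq → trans (sym (join-splitAt k l i))
        (trans (cong (join k l) (inj (splitAt k i) (splitAt k j) eq)) (join-splitAt k l j))
    ; sound     = λ i → snd (splitAt k i)
    ; complete  = comp
    }
    where
    f = Sum.map r s
    inj : ∀ x y → f x ≡ f y → x ≡ y
    inj (inj₁ i) (inj₁ j) eq = cong inj₁ (injective R (inj₁-injective eq))
    inj (inj₂ i) (inj₂ j) eq = cong inj₂ (injective S (inj₂-injective eq))
    snd : ∀ x → Sum.[ P , Q ] (f x)
    snd (inj₁ i) = sound R i
    snd (inj₂ j) = sound S j
    comp : ∀ {x} → Sum.[ P , Q ] x → ∃ λ i → f (splitAt k i) ≡ x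
    comp {inj₁ x} Px with complete R Px
    ... | i , refl = join k l (inj₁ i) , cong f (splitAt-join k l (inj₁ i))
    comp {inj₂ y} Qy with complete S Qy
    ... | j , refl = join k l (inj₂ j) , cong f (splitAt-join k l (inj₂ j))

  enumerates-id : Enumerates (id {A = Fin k}) (λ _ → ⊤)
  enumerates-id = record { injective = id ; sound = λ _ → tt ; complete = λ {i} _ → i , refl }

  enumerates-enumerate : ∀ {m} (p : Subset m) → Enumerates (enumerate p) (_∈ p)
  enumerates-enumerate p = record { injective = inj p _ _ ; sound = snd p ; complete = comp p _ }
    where
    inj : ∀ {m} (p : Subset m) i j → enumerate p i ≡ enumerate p j → i ≡ j
    inj (inside  ∷ p) zero    zero    eq = refl
    inj (inside  ∷ p) (suc i) (suc j) eq = cong suc (inj p i j (suc-injective eq))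
    inj (outside ∷ p) i       j       eq = inj p i j (suc-injective eq)
    snd : ∀ {m} (p : Subset m) i → enumerate p i ∈ p
    snd (inside  ∷ p) zero    = here
    snd (inside  ∷ p) (suc i) = there (snd p i)
    snd (outside ∷ p) i       = there (snd p i)
    comp : ∀ {m} (p : Subset m) x → x ∈ p → ∃ λ i → enumerate p i ≡ x
    comp (inside  ∷ p) zero    here        = zero , refl
    comp (inside  ∷ p) (suc x) (there x∈p) = let i , eq = comp p x x∈p in suc i , cong suc eq
    comp (outside ∷ p) (suc x) (there x∈p) = let i , eq = comp p x x∈p in i , cong suc eq

  enumerates-∁ : ∀ {m} (p : Subset m) → Enumerates (enumerate (∁ p)) (_∉ p)
  enumerates-∁ p = enumerates-⇔ x∈∁p⇒x∉p x∉p⇒x∈∁p (enumerates-enumerate (∁ p))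

  onto-⊎ : {X′ Y′ : Set} {φ : X → X′} {ψ : Y → Y′}
    {P : X → Set} {P′ : X′ → Set} {Q : Y → Set} {Q′ : Y′ → Set} →
    Onto φ P P′ → Onto ψ Q Q′ → Onto (Sum.map φ ψ) Sum.[ P , Q ] Sum.[ P′ , Q′ ]
  onto-⊎ Φ Ψ = record
    { φ-injective = λ { {inj₁ _} {inj₁ _} eq → cong inj₁ (φ-injective Φ (inj₁-injective eq))
                      ; {inj₂ _} {inj₂ _} eq → cong inj₂ (φ-injective Ψ (inj₂-injective eq))
                      ; {inj₁ _} {inj₂ _} ()
                      ; {inj₂ _} {inj₁ _} () }
    ; into        = λ { {inj₁ _} → into Φ ; {inj₂ _} → into Ψ }
    ; onto        = λ { {inj₁ _} p → let x , Px , eq = onto Φ p in inj₁ x , Px , cong inj₁ eq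
                      ; {inj₂ _} q → let y , Qy , eq = onto Ψ q in inj₂ y , Qy , cong inj₂ eq }
    }

  onto-⇔ : {φ : X → Y} {P : X → Set} {Q Q′ : Y → Set} →
    (∀ {y} → Q y → Q′ y) → (∀ {y} → Q′ y → Q y) → Onto φ P Q → Onto φ P Q′
  onto-⇔ to from Φ = record { φ-injective = φ-injective Φ ; into = to ∘ into Φ ; onto = onto Φ ∘ from }

  onto-id : Onto id P P
  onto-id = record { φ-injective = id ; into = id ; onto = λ Px → _ , Px , refl }

  onto-punchIn : (w : Fin (suc k)) → Onto (punchIn w) (λ _ → ⊤) (_≢ w)
  onto-punchIn w = record
    { φ-injective = punchIn-injective w _ _
    ; into        = λ _ → punchInᵢ≢i w _
    ; onto        = λ x≢w → punchOut (x≢w ∘ sym) , tt , punchIn-punchOut (x≢w ∘ sym)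
    }

open Enumerations

-- Determinants over a commutative ring

module DeterminantProperties (R : CommutativeRing 0ℓ 0ℓ) where
  open CommutativeRing R hiding (zero)
  open Determinant rawRing public
  open import Algebra.Definitions.RawSemiring (RawRing.rawSemiring rawRing) using (_^_)
  open import Algebra.Properties.Ring ring
  open import Algebra.Properties.Semiring.Sum semiring public
  open import Relation.Binary.Reasoning.Setoid setoid
  private module *-Solver = CommutativeMonoidSolver *-commutativeMonoid

  sgn : ∀ {k} → Fin k → Carrier
  sgn j = (- 1#) ^ toℕ j

  sum-zero : ∀ {k} {f : Fin k → Carrier} → (∀ i → f i ≈ 0#) → sum f ≈ 0#
  sum-zero {k} f≈0 = trans (sum-cong-≋ f≈0) (sum-replicate-zero k)

  sum-neg : ∀ {l} (f : Fin l → Carrier) → sum (λ i → - f i) ≈ - sum f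
  sum-neg f = trans (sum-cong-≋ λ i → sym (-1*x≈-x (f i)))
    (trans (sym (*-distribˡ-sum (- 1#) f)) (-1*x≈-x (sum f)))

  det-cong : ∀ {k} {M N : Matrix Carrier k} → (∀ r c → M r c ≈ N r c) → det M ≈ det N
  det-cong {zero}  M≈N = refl
  det-cong {suc k} M≈N = sum-cong-≋ λ j →
    *-cong (*-congˡ {sgn j} (M≈N zero j)) (det-cong λ r c → M≈N (suc r) (punchIn j c))

  -- Expand along the first row, and the minors not containing the
  -- corner along their first column: both sides become the same double
  -- sum.
  det-transpose : ∀ {k} (M : Matrix Carrier k) → det M ≈ det (flip M)
  det-transpose {zero}        M = refl
  det-transpose {suc zero}    M = refl
  det-transpose {suc (suc k)} M = +-cong
    (*-congˡ (det-transpose λ r c → M (suc r) (suc c)))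
    (begin
      (sum λ j → sgn (suc j) * a j * det (minor j))
        ≈⟨ (sum-cong-≋ λ j → trans (*-congˡ (det-transpose (minor j)))
             (*-distribˡ-sum (sgn (suc j) * a j) λ i → sgn i * b i * det (flip (minor² i j)))) ⟩
      (sum λ j → sum λ i → sgn (suc j) * a j * (sgn i * b i * det (flip (minor² i j))))
        ≈⟨ (∑-comm λ j i → sgn (suc j) * a j * (sgn i * b i * det (flip (minor² i j)))) ⟩
      (sum λ i → sum λ j → sgn (suc j) * a j * (sgn i * b i * det (flip (minor² i j))))
        ≈⟨ (sum-cong-≋ λ i → sum-cong-≋ λ j →
             trans (exchange (- 1#) (sgn j) (a j) (sgn i) (b i) (det (flip (minor² i j))))
                   (*-congˡ (*-congˡ (sym (det-transpose (minor² i j)))))) ⟩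
      (sum λ i → sum λ j → sgn (suc i) * b i * (sgn j * a j * det (minor² i j)))
        ≈⟨ (sum-cong-≋ λ i → *-distribˡ-sum (sgn (suc i) * b i) λ j → sgn j * a j * det (minor² i j)) ⟨
      (sum λ i → sgn (suc i) * b i * sum λ j → sgn j * a j * det (minor² i j))
        ≈⟨ (sum-cong-≋ λ i → *-congˡ {sgn (suc i) * b i} (sym (det-transpose (cofactor i)))) ⟩
      (sum λ i → sgn (suc i) * b i * det (cofactor i)) ∎)
    where
    a b : Fin (suc k) → Carrier
    a j = M zero (suc j)
    b i = M (suc i) zero
    minor : Fin (suc k) → Matrix Carrier (suc k)
    minor j r c = M (suc r) (punchIn (suc j) c)
    cofactor : Fin (suc k) → Matrix Carrier (suc k)
    cofactor i r c = M (punchIn (suc i) c) (suc r)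
    minor² : (i j : Fin (suc k)) → Matrix Carrier k
    minor² i j r c = M (suc (punchIn i r)) (suc (punchIn j c))
    exchange : ∀ m x a y b d → m * x * a * (y * b * d) ≈ m * y * b * (x * a * d)
    exchange = solve 6 (λ m x a y b d →
      ((m ⊕ x) ⊕ a) ⊕ ((y ⊕ b) ⊕ d) ⊜ ((m ⊕ y) ⊕ b) ⊕ ((x ⊕ a) ⊕ d)) refl
      where open *-Solver

  -- Each term of the first-row expansion takes `ε zero` from its entry and the factor of the later
  -- rows from its minor. The factor is chosen before `M`, so all minors of the expansion share it.
  det-scaleRows : ∀ {k} (ε : Fin k → Carrier) →
    ∃ λ x → ∀ M → det (λ r c → ε r * M r c) ≈ x * det M
  det-scaleRows {zero}  ε = 1# , λ M → sym (*-identityˡ 1#)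
  det-scaleRows {suc k} ε with det-scaleRows (ε ∘ suc)
  ... | x , scale = ε zero * x , λ M → trans
    (sum-cong-≋ λ j → trans (*-congˡ {sgn j * (ε zero * M zero j)} (scale λ r c → M (suc r) (punchIn j c)))
                            (rearrange (sgn j) (ε zero) (M zero j) x _))
    (sym (*-distribˡ-sum (ε zero * x) λ j → sgn j * M zero j * det λ r c → M (suc r) (punchIn j c)))
    where
    rearrange : ∀ s e a x d → s * (e * a) * (x * d) ≈ e * x * (s * a * d)
    rearrange = solve 5 (λ s e a x d →
      (s ⊕ (e ⊕ a)) ⊕ (x ⊕ d) ⊜ (e ⊕ x) ⊕ ((s ⊕ a) ⊕ d)) refl
      where open *-Solver

  *-zero : ∀ {x y} z → y ≈ z * x → x ≈ 0# → y ≈ 0#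
  *-zero z y≈zx x≈0 = trans y≈zx (trans (*-congˡ x≈0) (zeroʳ z))

  det-scale≈0 : ∀ {k} (ε η : Fin k → Carrier) (M : Matrix Carrier k) →
    det M ≈ 0# → det (λ r c → ε r * M r c * η c) ≈ 0#
  det-scale≈0 ε η M M≈0 = begin
    det (λ r c → ε r * M r c * η c)    ≈⟨ det-transpose (λ r c → ε r * M r c * η c) ⟩
    det (λ c r → ε r * M r c * η c)    ≈⟨ det-cong {M = λ c r → ε r * M r c * η c}
                                            (λ c r → *-comm (ε r * M r c) (η c)) ⟩
    det (λ c r → η c * (ε r * M r c))  ≈⟨ *-zero _ (proj₂ (det-scaleRows η) _) (begin
      det (λ c r → ε r * M r c)          ≈⟨ det-transpose (λ c r → ε r * M r c) ⟩
      det (λ r c → ε r * M r c)          ≈⟨ *-zero _ (proj₂ (det-scaleRows ε) M) M≈0 ⟩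
      0#                                 ∎) ⟩
    0#                                 ∎

  -- The sign may be any ring element, since only vanishing is to be transported. It must not depend
  -- on `M`: this is what makes signs compose and pass through expansions.
  record HasSign {k} (σ : Fin k → Fin k) : Set where
    constructor _,_
    field
      sign     : Carrier
      det-sign : ∀ M → det (λ r c → M r (σ c)) ≈ sign * det M
  open HasSign

  hasSign-id : ∀ {k} → HasSign {k} id
  hasSign-id = 1# , λ M → sym (*-identityˡ (det M))

  hasSign-∘ : ∀ {k} {σ τ : Fin k → Fin k} → HasSign σ → HasSign τ → HasSign (σ ∘ τ)
  hasSign-∘ {σ = σ} (x , hx) (y , hy) = y * x , λ M →
    trans (hy λ r c → M r (σ c)) (trans (*-congˡ (hx M)) (sym (*-assoc y x (det M))))

  hasSign-≗ : ∀ {k} {σ τ : Fin k → Fin k} → σ ≗ τ → HasSign σ → HasSign τ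
  hasSign-≗ σ≗τ (x , hx) = x , λ M →
    trans (det-cong λ r c → reflexive (≡.cong (M r) (≡.sym (σ≗τ c)))) (hx M)

  lift : ∀ {k} → (Fin k → Fin k) → Fin (suc k) → Fin (suc k)
  lift σ = zero F.∷ λ j → suc (σ j)

  det-expandColumn : ∀ {k} (M : Matrix Carrier (suc k)) →
    det M ≈ sum λ i → sgn i * M i zero * det λ r c → M (punchIn i r) (suc c)
  det-expandColumn M = trans (det-transpose M) (sum-cong-≋ λ i →
    *-congˡ {sgn i * M i zero} (det-transpose λ r c → M (punchIn i c) (suc r)))

  -- `lift σ` fixes the first column, so after expansion along that column `σ` acts on the columns
  -- of every minor.
  hasSign-lift : ∀ {k} {σ : Fin k → Fin k} → HasSign σ → HasSign (lift σ)
  hasSign-lift {σ = σ} (x , hx) = x , λ M → begin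
    det (λ r c → M r (lift σ c))
      ≈⟨ det-expandColumn (λ r c → M r (lift σ c)) ⟩
    (sum λ i → sgn i * M i zero * det λ r c → M (punchIn i r) (suc (σ c)))
      ≈⟨ (sum-cong-≋ λ i → trans (*-congˡ {sgn i * M i zero} (hx λ r c → M (punchIn i r) (suc c)))
            (exchange (sgn i * M i zero) x _)) ⟩
    (sum λ i → x * (sgn i * M i zero * det λ r c → M (punchIn i r) (suc c)))
      ≈⟨ *-distribˡ-sum x (λ i → sgn i * M i zero * det λ r c → M (punchIn i r) (suc c)) ⟨
    x * (sum λ i → sgn i * M i zero * det λ r c → M (punchIn i r) (suc c))
      ≈⟨ *-congˡ (det-expandColumn M) ⟨
    x * det M ∎
    where
    exchange : ∀ a x d → a * (x * d) ≈ x * (a * d)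
    exchange = solve 3 (λ a x d → a ⊕ (x ⊕ d) ⊜ x ⊕ (a ⊕ d)) refl
      where open *-Solver

  swap₀₁ : ∀ {k} → Fin (suc (suc k)) → Fin (suc (suc k))
  swap₀₁ = 1F F.∷ 0F F.∷ λ j → suc (suc j)

  -- The exchange interchanges the first two terms of the expansion, whose signs are opposite. In
  -- every other term it survives as an exchange of the first two columns of the minor, and
  -- induction applies.
  det-swap₀₁ : ∀ {k} (M : Matrix Carrier (suc (suc k))) →
    det (λ r c → M r (swap₀₁ c)) ≈ - det M
  det-swap₀₁ {k} M = begin
    1# * M 0F 1F * det (λ r c → M (suc r) (swap₀₁ (punchIn 0F c)))
      + (- 1# * 1# * M 0F 0F * det (λ r c → M (suc r) (swap₀₁ (punchIn 1F c)))
      + sum (λ j → sgn (suc (suc j)) * M 0F (suc (suc j))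
                     * det (λ r c → M (suc r) (swap₀₁ (punchIn (suc (suc j)) c)))))
      ≈⟨ +-cong (*-congˡ {1# * M 0F 1F} (det-cong {suc k}
            {λ r c → M (suc r) (swap₀₁ (punchIn 0F c))} {λ r c → M (suc r) (punchIn 1F c)}
            λ { r zero → refl ; r (suc c) → refl }))
          (+-cong (*-congˡ { - 1# * 1# * M 0F 0F} (det-cong {suc k}
              {λ r c → M (suc r) (swap₀₁ (punchIn 1F c))} {λ r c → M (suc r) (punchIn 0F c)}
              λ { r zero → refl ; r (suc c) → refl }))
            (sum-cong-≋ (higher k M))) ⟩
    1# * b * B + (- 1# * 1# * a * A + sum (λ j → - t j))
      ≈⟨ +-cong (trans (*-congʳ (*-identityˡ b)) (sym (-‿involutive _))) (+-cong
           (trans (*-congʳ (trans (*-assoc _ _ _) (-1*x≈-x (1# * a)))) (sym (-‿distribˡ-* (1# * a) A)))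
           (sum-neg t)) ⟩
    - - (b * B) + (- (1# * a * A) + - sum t)
      ≈⟨ +-cong (-‿cong (trans (-‿distribˡ-* b B)
                         (*-congʳ (sym (trans (*-congʳ (*-identityʳ (- 1#))) (-1*x≈-x b))))))
                (-‿+-comm (1# * a * A) (sum t)) ⟩
    - (- 1# * 1# * b * B) + - (1# * a * A + sum t)
      ≈⟨ -‿+-comm _ _ ⟩
    - (- 1# * 1# * b * B + (1# * a * A + sum t))
      ≈⟨ -‿cong (trans (sym (+-assoc _ _ _)) (trans (+-congʳ (+-comm _ _)) (+-assoc _ _ _))) ⟩
    - det M ∎
    where
    a = M 0F 0F
    b = M 0F 1F
    A = det {suc k} λ r c → M (suc r) (punchIn 0F c)
    B = det {suc k} λ r c → M (suc r) (punchIn 1F c)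
    t : Fin k → Carrier
    t j = sgn (suc (suc j)) * M 0F (suc (suc j)) * det λ r c → M (suc r) (punchIn (suc (suc j)) c)
    higher : ∀ k (M : Matrix Carrier (suc (suc k))) (j : Fin k) →
      sgn (suc (suc j)) * M 0F (suc (suc j)) * det (λ r c → M (suc r) (swap₀₁ (punchIn (suc (suc j)) c)))
      ≈ - (sgn (suc (suc j)) * M 0F (suc (suc j)) * det λ r c → M (suc r) (punchIn (suc (suc j)) c))
    higher (suc k) M j = trans
      (*-congˡ {sgn (suc (suc j)) * M 0F (suc (suc j))} (trans
        (det-cong {M = λ r c → M (suc r) (swap₀₁ (punchIn (suc (suc j)) c))}
                  {λ r c → M (suc r) (punchIn (suc (suc j)) (swap₀₁ c))}
          λ { r zero → refl ; r (suc zero) → refl ; r (suc (suc c)) → refl })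
        (det-swap₀₁ λ r c → M (suc r) (punchIn (suc (suc j)) c))))
      (sym (-‿distribʳ-* _ _))

  hasSign-swap₀₁ : ∀ {k} → HasSign {suc (suc k)} swap₀₁
  hasSign-swap₀₁ = - 1# , λ M → trans (det-swap₀₁ M) (sym (-1*x≈-x (det M)))

  -- Column `suc a` is brought to the front of the columns after the first, and then the first two
  -- columns are exchanged.
  hasSign-front : ∀ {k} (a : Fin (suc k)) → HasSign (a F.∷ punchIn a)
  hasSign-front zero = hasSign-≗ (λ { zero → ≡.refl ; (suc c) → ≡.refl }) hasSign-id
  hasSign-front {suc k} (suc a) =
    hasSign-≗ (λ { zero → ≡.refl ; (suc zero) → ≡.refl ; (suc (suc c)) → ≡.refl })
      (hasSign-∘ (hasSign-lift (hasSign-front a)) hasSign-swap₀₁)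

  -- Once the image of `zero` stands in front, what remains is `π` with `zero` removed, a
  -- permutation of one column fewer.
  hasSign-permutation : ∀ {k} (π : Permutation′ k) → HasSign (π ⟨$⟩ʳ_)
  hasSign-permutation {zero}  π = hasSign-≗ (λ ()) hasSign-id
  hasSign-permutation {suc k} π =
    hasSign-≗ (λ { zero → ≡.refl ; (suc c) → ≡.sym (Perm.punchIn-permute π zero c) })
      (hasSign-∘ (hasSign-front (π ⟨$⟩ʳ zero))
                 (hasSign-lift (hasSign-permutation (Perm.remove zero π))))

  det-permute≈0 : ∀ {k} (π ρ : Permutation′ k) (M : Matrix Carrier k) →
    det M ≈ 0# → det (λ r c → M (π ⟨$⟩ʳ r) (ρ ⟨$⟩ʳ c)) ≈ 0#
  det-permute≈0 π ρ M M≈0 =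
    *-zero _ (det-sign (hasSign-permutation ρ) λ r c → M (π ⟨$⟩ʳ r) c)
      (trans (det-transpose λ r c → M (π ⟨$⟩ʳ r) c) (*-zero _ (det-sign (hasSign-permutation π) (flip M))
        (trans (sym (det-transpose M)) M≈0)))

  -- Antisymmetry would only show that twice the determinant vanishes. In the expansion the first
  -- two terms cancel outright, and the other minors still contain both equal columns.
  det-columns₀₁ : ∀ {k} (M : Matrix Carrier (suc (suc k))) →
    (∀ r → M r 0F ≈ M r 1F) → det M ≈ 0#
  det-columns₀₁ {k} M eq = begin
    1# * M 0F 0F * A + (- 1# * 1# * M 0F 1F * B + sum t)
      ≈⟨ +-cong (*-cong (trans (*-identityˡ _) (eq 0F))
            (det-cong {M = λ r c → M (suc r) (punchIn 0F c)} {λ r c → M (suc r) (punchIn 1F c)}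
              λ { r zero → sym (eq (suc r)) ; r (suc c) → refl }))
          (+-cong (trans (*-congʳ (trans (*-congʳ (*-identityʳ (- 1#))) (-1*x≈-x _)))
                       (sym (-‿distribˡ-* _ B)))
            (sum-zero (higher k M eq))) ⟩
    M 0F 1F * B + (- (M 0F 1F * B) + 0#)  ≈⟨ +-congˡ (+-identityʳ _) ⟩
    M 0F 1F * B + - (M 0F 1F * B)         ≈⟨ -‿inverseʳ _ ⟩
    0# ∎
    where
    A = det {suc k} λ r c → M (suc r) (punchIn 0F c)
    B = det {suc k} λ r c → M (suc r) (punchIn 1F c)
    t : Fin k → Carrier
    t j = sgn (suc (suc j)) * M 0F (suc (suc j)) * det λ r c → M (suc r) (punchIn (suc (suc j)) c)
    higher : ∀ k (M : Matrix Carrier (suc (suc k))) → (∀ r → M r 0F ≈ M r 1F) → (j : Fin k) →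
      sgn (suc (suc j)) * M 0F (suc (suc j)) * det (λ r c → M (suc r) (punchIn (suc (suc j)) c)) ≈ 0#
    higher (suc k) M eq j = *-zero _ refl
      (det-columns₀₁ (λ r c → M (suc r) (punchIn (suc (suc j)) c)) λ r → eq (suc r))

  -- A permutation of the columns after the first moves column `j` next to its copy;
  -- `insert zero j id` is one that sends `zero` to `j`.
  det-repeatedColumn : ∀ {k} (M : Fin (suc k) → Fin k → Carrier) (j : Fin k) →
    det (λ r → M r j F.∷ M r) ≈ 0#
  det-repeatedColumn {suc k} M j =
    trans (det-cong {M = λ r → M r j F.∷ M r} {λ r c → P r (lift (π ⟨$⟩ˡ_) c)}
            λ { r zero → refl ; r (suc c) → reflexive (≡.cong (M r) (≡.sym (Perm.inverseʳ π))) })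
      (*-zero _ (det-sign (hasSign-lift (hasSign-permutation (Perm.flip π))) P)
        (det-columns₀₁ P λ r → refl))
    where
    π : Permutation′ (suc k)
    π = Perm.insert zero j Perm.id
    P : Matrix Carrier (suc (suc k))
    P r = M r j F.∷ (M r ∘ (π ⟨$⟩ʳ_))

  -- The corner occurs in the first term of the expansion only, so the matrices may differ there. In
  -- `det-peel` the corner is where the variable stands.
  det-splitCorner : ∀ {k} (M N : Matrix Carrier (suc k)) {x} → M zero zero ≈ x →
    (∀ j → M zero (suc j) ≈ N zero (suc j)) → (∀ i c → M (suc i) c ≈ N (suc i) c) →
    det M ≈ x * det (λ r c → N (suc r) (suc c))
      + sum λ j → sgn (suc j) * N zero (suc j) * det λ r c → N (suc r) (punchIn (suc j) c)
  det-splitCorner M N M₀₀≈x M₀≈N₀ M₁≈N₁ = +-cong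
    (*-cong (trans (*-identityˡ (M zero zero)) M₀₀≈x) (det-cong λ r c → M₁≈N₁ r (suc c)))
    (sum-cong-≋ λ j → *-cong (*-congˡ {sgn (suc j)} (M₀≈N₀ j)) (det-cong λ r c → M₁≈N₁ r (punchIn (suc j) c)))

-- Row and column sets, and singular submatrices

-- The labels of the rows or columns of M_G left after deleting those in `I`; `w` is the vertex
-- whose incidence column was deleted.
Kept : ∀ {m n} → Subset m → Fin n → Fin m ⊎ Fin n → Set
Kept I w = Sum.[ _∉ I , _≢ w ]

inj₁-≟ : ∀ {m n} (e : Fin m) (y : Fin m ⊎ Fin n) → y ≡ inj₁ e ⊎ y ≢ inj₁ e
inj₁-≟ e (inj₁ f) = Sum.map (≡.cong inj₁) (_∘ inj₁-injective) (toSum (f ≟ e))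
inj₁-≟ e (inj₂ w) = inj₂ λ ()

inj₂-≟ : ∀ {m n} (v : Fin n) (y : Fin m ⊎ Fin n) → y ≡ inj₂ v ⊎ y ≢ inj₂ v
inj₂-≟ v (inj₁ f) = inj₂ λ ()
inj₂-≟ v (inj₂ w) = Sum.map (≡.cong inj₂) (_∘ inj₂-injective) (toSum (w ≟ v))

module SingularMatrices (R : CommutativeRing 0ℓ 0ℓ) where
  open CommutativeRing R hiding (zero; _-_)
  open DeterminantProperties R
  open import Algebra.Properties.Ring ring
  open import Relation.Binary.Reasoning.Setoid setoid

  private variable
    X Y X′ Y′ : Set
    M M′ : X → Y → Carrier
    P P′ Q Q′ : X → Set
    m n m′ n′ k : ℕ
    x y z : X

  -- Two enumerations differ by a permutation, so one choice of r and s is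
  -- as good as all of them: see `singular-from`.  If P and Q have different
  -- sizes, the condition is void.
  record Singular {X Y : Set} (M : X → Y → Carrier) (P : X → Set) (Q : Y → Set) : Set where
    constructor singular
    field
      vanishes : ∀ {k} {r : Fin k → X} {s : Fin k → Y} → Enumerates r P → Enumerates s Q →
        det (λ i j → M (r i) (s j)) ≈ 0#

  open Singular public

  singular-from : {r : Fin k → X} {s : Fin k → Y} → Enumerates r P → Enumerates s Q →
    det (λ i j → M (r i) (s j)) ≈ 0# → Singular M P Q
  singular-from {M = M} {r = r} {s} R S det≈0 = singular λ {l} {r′} {s′} R′ S′ → go R′ S′
    where
    go : ∀ {l} {r′ : Fin l → _} {s′ : Fin l → _} → Enumerates r′ _ → Enumerates s′ _ →
      det (λ i j → M (r′ i) (s′ j)) ≈ 0#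
    go R′ S′ with enumerates-size R R′
    ... | ≡.refl = let π , r∘π = reenumeration R R′ ; ρ , s∘ρ = reenumeration S S′ in
      trans (det-cong λ i j → reflexive (≡.cong₂ M (≡.sym (r∘π i)) (≡.sym (s∘ρ j))))
            (det-permute≈0 π ρ (λ i j → M (r i) (s j)) det≈0)

  singular-transpose : Singular M P Q → Singular (flip M) Q P
  singular-transpose {M = M} sing = singular λ {k} {s} {r} S R →
    trans (det-transpose λ j i → M (r i) (s j)) (vanishes sing R S)

  singular-relabel : Singular M P Q → {φ : X′ → X} {ψ : Y′ → Y} → Onto φ P′ P → Onto ψ Q′ Q →
    (ε : X′ → Carrier) (η : Y′ → Carrier) →
    (∀ {x y} → P′ x → Q′ y → M′ x y ≈ ε x * M (φ x) (ψ y) * η y) → Singular M′ P′ Q′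
  singular-relabel {M = M} sing {φ} {ψ} Φ Ψ ε η eq = singular λ {k} {r} {s} R S →
    trans (det-cong λ i j → eq (sound R i) (sound S j))
      (det-scale≈0 (ε ∘ r) (η ∘ s) (λ i j → M (φ (r i)) (ψ (s j)))
        (vanishes sing (enumerates-image Φ R) (enumerates-image Ψ S)))

  -- Expansion along row `x` leaves the pivot times the smaller determinant. A pivot that is its own
  -- inverse can be cancelled without a notion of unit, and the pivots that occur are 1 and -1.
  singular-pivot : Singular M P Q →
    P x → (∀ z → z ≡ x ⊎ z ≢ x) → Q y → (∀ z → z ≡ y ⊎ z ≢ y) →
    M x y * M x y ≈ 1# → (∀ {z} → Q z → z ≢ y → M x z ≈ 0#) →
    Singular M (P - x) (Q - y)
  singular-pivot {M = M} {x = x} {y = y} sing Px x? Qy y? unit row≈0 = singular λ {k} {r} {s} R S →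
    let d = det (λ i j → M (r i) (s j))
        others = λ j → sgn (suc j) * M x (s j) * det λ i c → M (r i) ((y F.∷ s) (punchIn (suc j) c))
    in begin
    d                        ≈⟨ *-identityˡ d ⟨
    1# * d                   ≈⟨ *-congʳ unit ⟨
    M x y * M x y * d        ≈⟨ *-assoc _ _ _ ⟩
    M x y * (M x y * d)      ≈⟨ *-congˡ (begin
      M x y * d                 ≈⟨ *-congʳ (*-identityˡ (M x y)) ⟨
      1# * M x y * d            ≈⟨ +-identityʳ _ ⟨
      1# * M x y * d + 0#       ≈⟨ +-congˡ {1# * M x y * d} (sum-zero {f = others} λ j →
                                     trans (*-congʳ (*-congˡ {sgn (suc j)}
                                       (row≈0 (proj₁ (sound S j)) (proj₂ (sound S j)))))
                                     (trans (*-congʳ (zeroʳ (sgn (suc j)))) (zeroˡ _))) ⟨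
      1# * M x y * d + sum others
        ≈⟨ vanishes sing (enumerates-cons Px x? R) (enumerates-cons Qy y? S) ⟩
      0#                        ∎) ⟩
    M x y * 0#               ≈⟨ zeroʳ _ ⟩
    0#                       ∎

  sum-enumerates : {l : ℕ} {P : X → Set} {r : Fin k → X} {s : Fin l → X} (f : X → Carrier) →
    Enumerates r P → Enumerates s P → sum (f ∘ r) ≈ sum (f ∘ s)
  sum-enumerates {r = r} f R S = let π , r∘π = reenumeration R S in
    trans (sum-permute (f ∘ r) π) (sum-cong-≋ λ i → reflexive (≡.cong f (r∘π i)))

  sum-splitAt : ∀ k {n} (f : Fin k ⊎ Fin n → Carrier) →
    sum (f ∘ splitAt k) ≈ sum (f ∘ inj₁) + sum (f ∘ inj₂)
  sum-splitAt zero    f = sym (+-identityˡ _)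
  sum-splitAt (suc k) f = trans (+-congˡ (sum-splitAt k (f ∘ Sum.map₁ suc))) (sym (+-assoc _ _ _))

  -- The determinant is linear in its first column, and the combination of the columns of `M`
  -- contributes only determinants with a repeated column. So those with first columns `x` and `y`
  -- add up to zero.
  det-replaceColumn : (M : Fin (suc k) → Fin k → Carrier) (x y : Fin (suc k) → Carrier)
    (t : Fin k → Carrier) → (∀ r → x r + (y r + sum λ j → t j * M r j) ≈ 0#) →
    det (λ r → y r F.∷ M r) ≈ 0# → det (λ r → x r F.∷ M r) ≈ 0#
  det-replaceColumn {k} M x y t eq y≈0 = begin
    det (λ r → x r F.∷ M r)        ≈⟨ det-expandColumn (λ r → x r F.∷ M r) ⟩
    E x                            ≈⟨ +-identityʳ (E x) ⟨
    E x + 0#                       ≈⟨ +-congˡ (begin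
      E (λ r → y r + combination r)
        ≈⟨ E-+ y combination ⟩
      E y + E combination
        ≈⟨ +-cong (trans (sym (det-expandColumn λ r → y r F.∷ M r)) y≈0) combination≈0 ⟩
      0# + 0#
        ≈⟨ +-identityˡ 0# ⟩
      0# ∎) ⟨
    E x + E (λ r → y r + combination r)
      ≈⟨ E-+ x (λ r → y r + combination r) ⟨
    E (λ r → x r + (y r + combination r))
      ≈⟨ sum-zero {f = λ i → sgn i * (x i + (y i + combination i)) * cofactor i}
           (λ i → trans (*-congʳ (trans (*-congˡ {sgn i} (eq i)) (zeroʳ (sgn i)))) (zeroˡ (cofactor i))) ⟩
    0#                             ∎
    where
    cofactor : Fin (suc k) → Carrier
    cofactor i = det λ r c → M (punchIn i r) c
    -- The determinant with first column `z`, already expanded along it so that linearity is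
    -- visible.
    E : (Fin (suc k) → Carrier) → Carrier
    E z = sum λ i → sgn i * z i * cofactor i
    combination : Fin (suc k) → Carrier
    combination r = sum λ j → t j * M r j
    E-+ : ∀ z z′ → E (λ r → z r + z′ r) ≈ E z + E z′
    E-+ z z′ = trans (sum-cong-≋ λ i →
      trans (*-congʳ (distribˡ (sgn i) (z i) (z′ i))) (distribʳ (cofactor i) (sgn i * z i) (sgn i * z′ i)))
      (∑-distrib-+ (λ i → sgn i * z i * cofactor i) λ i → sgn i * z′ i * cofactor i)
    term : ∀ i j → sgn i * (t j * M i j) * cofactor i ≈ t j * (sgn i * M i j * cofactor i)
    term i j = trans
      (*-congʳ (trans (sym (*-assoc _ _ _)) (trans (*-congʳ (*-comm _ _)) (*-assoc _ _ _))))
      (*-assoc _ _ _)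
    combination≈0 : E combination ≈ 0#
    combination≈0 = begin
      E combination
        ≈⟨ (sum-cong-≋ λ i → trans (*-congʳ (*-distribˡ-sum (sgn i) λ j → t j * M i j))
             (*-distribʳ-sum (cofactor i) λ j → sgn i * (t j * M i j))) ⟩
      (sum λ i → sum λ j → sgn i * (t j * M i j) * cofactor i)
        ≈⟨ (∑-comm λ i j → sgn i * (t j * M i j) * cofactor i) ⟩
      (sum λ j → sum λ i → sgn i * (t j * M i j) * cofactor i)
        ≈⟨ (sum-cong-≋ λ j → trans (sum-cong-≋ λ i → term i j)
             (sym (*-distribˡ-sum (t j) λ i → sgn i * M i j * cofactor i))) ⟩
      (sum λ j → t j * E (λ r → M r j))
        ≈⟨ (sum-zero {f = λ j → t j * E (λ r → M r j)} λ j → *-zero (t j)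
             (*-congˡ (sym (det-expandColumn λ r → M r j F.∷ M r))) (det-repeatedColumn M j)) ⟩
      0# ∎

  -- Column w is minus the sum of the other columns in inj₂, and only w′
  -- among these is not already present.
  singular-rebase : {M : X → Fin m ⊎ Fin n → Carrier} (J : Subset m) (w w′ : Fin n) →
    (∀ x → sum (M x ∘ inj₂) ≈ 0#) → Singular M P (Kept J w) → Singular M P (Kept J w′)
  singular-rebase {P = P} {M = M} J w w′ sum≈0 sing with w ≟ w′
  ... | yes ≡.refl = sing
  ... | no  w≢w′   = singular go
    where
    go : ∀ {k} {r : Fin k → _} {s : Fin k → _} → Enumerates r P → Enumerates s (Kept J w′) →
      det (λ i j → M (r i) (s j)) ≈ 0#
    -- `w` is among the columns kept when `w′` is deleted; taking it out leaves `σ`, the columns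
    -- common to both sides.
    go {r = r} R S with enumerates-without {x = inj₂ w} S w≢w′
    ... | l , σ , ≡.refl , Σ = vanishes (singular-from {M = M} R (enumerates-cons w≢w′ (inj₂-≟ w) Σ)
            (trans (det-cong {M = λ i j → M (r i) ((inj₂ w F.∷ σ) j)}
                             {λ i → M (r i) (inj₂ w) F.∷ λ j → M (r i) (σ j)}
                     λ { i zero → refl ; i (suc j) → refl })
              (det-replaceColumn (λ i j → M (r i) (σ j)) (λ i → M (r i) (inj₂ w)) (λ i → M (r i) (inj₂ w′))
                (weight ∘ σ) (relation ∘ r)
                (trans (det-cong {M = λ i → M (r i) (inj₂ w′) F.∷ λ j → M (r i) (σ j)}
                                 {λ i j → M (r i) ((inj₂ w′ F.∷ σ) j)}
                     λ { i zero → refl ; i (suc j) → refl })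
                  (vanishes sing R (enumerates-cons (w≢w′ ∘ ≡.sym) (inj₂-≟ w′) Σ′))))))
            R S
      where
      -- The weight discards edge columns, since only the vertex columns satisfy a linear relation.
      weight : Fin _ ⊎ Fin _ → Carrier
      weight = Sum.[ (λ _ → 0#) , (λ _ → 1#) ]
      Σ′ : Enumerates σ (Kept J w - inj₂ w′)
      Σ′ = enumerates-⇔
        (λ { {inj₁ _} (e∉J , _) → e∉J , λ ()
           ; {inj₂ _} (v≢w′ , v≢w) → v≢w ∘ ≡.cong inj₂ , v≢w′ ∘ inj₂-injective })
        (λ { {inj₁ _} (e∉J , _) → e∉J , λ ()
           ; {inj₂ _} (v≢w , v≢w′) → v≢w′ ∘ ≡.cong inj₂ , v≢w ∘ inj₂-injective })
        Σ
      -- With `w` and `w′` both present, every vertex occurs exactly once, so the weighted sum is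
      -- the full row sum over the vertices.
      all : Enumerates (inj₂ w F.∷ inj₂ w′ F.∷ σ) Sum.[ _∉ J , (λ _ → ⊤) ]
      all = enumerates-cons _ (inj₂-≟ w) (enumerates-⇔
        (λ { {inj₁ _} e∉J → e∉J , λ () ; {inj₂ _} v≢w → _ , v≢w ∘ inj₂-injective })
        (λ { {inj₁ _} (e∉J , _) → e∉J ; {inj₂ _} (_ , v≢w) → v≢w ∘ ≡.cong inj₂ })
        (enumerates-cons (w≢w′ ∘ ≡.sym) (inj₂-≟ w′) Σ′))
      relation : ∀ x → M x (inj₂ w) + (M x (inj₂ w′) + sum λ j → weight (σ j) * M x (σ j)) ≈ 0#
      relation x = begin
        M x (inj₂ w) + (M x (inj₂ w′) + sum λ j → weight (σ j) * M x (σ j))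
          ≈⟨ +-cong (*-identityˡ _) (+-congʳ (*-identityˡ _)) ⟨
        sum (f ∘ (inj₂ w F.∷ inj₂ w′ F.∷ σ))
          ≈⟨ sum-enumerates f all (enumerates-⊎ (enumerates-∁ J) enumerates-id) ⟩
        sum (f ∘ Sum.map (enumerate (∁ J)) id ∘ splitAt ∣ ∁ J ∣)
          ≈⟨ sum-splitAt ∣ ∁ J ∣ (f ∘ Sum.map (enumerate (∁ J)) id) ⟩
        sum (f ∘ inj₁ ∘ enumerate (∁ J)) + sum (f ∘ inj₂)
          ≈⟨ +-cong (sum-zero {f = f ∘ inj₁ ∘ enumerate (∁ J)} λ i → zeroˡ _)
                    (trans (sum-cong-≋ λ v → *-identityˡ (M x (inj₂ v))) (sum≈0 x)) ⟩
        0# + 0#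
          ≈⟨ +-identityˡ 0# ⟩
        0# ∎
        where
        f : Fin _ ⊎ Fin _ → Carrier
        f z = weight z * M x z

  -- The incidence matrix and the matrix `L`

  δ : Fin n → Fin n → Carrier
  δ i j = if does (i ≟ j) then 1# else 0#

  δ-≡ : {i j : Fin n} → i ≡ j → δ i j ≡ 1#
  δ-≡ {i = i} {j} eq rewrite dec-true (i ≟ j) eq = ≡.refl

  δ-≢ : {i j : Fin n} → i ≢ j → δ i j ≡ 0#
  δ-≢ {i = i} {j} neq rewrite dec-false (i ≟ j) neq = ≡.refl

  δ-⇔ : {i j : Fin n} {i′ j′ : Fin k} → (i ≡ j → i′ ≡ j′) → (i′ ≡ j′ → i ≡ j) → δ i j ≡ δ i′ j′
  δ-⇔ {i = i} {j} {i′} {j′} to from =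
    ≡.cong (if_then 1# else 0#) (does-⇔ (mk⇔ to from) (i ≟ j) (i′ ≟ j′))

  sum-δ : (j : Fin n) → sum (λ i → δ i j) ≈ 1#
  sum-δ {suc n} j = trans (sum-remove {i = j} (λ i → δ i j))
    (trans (+-cong (reflexive (δ-≡ {i = j} ≡.refl))
                  (sum-zero {f = λ i → δ (punchIn j i) j} λ i → reflexive (δ-≢ (punchInᵢ≢i j i))))
      (+-identityʳ 1#))

  -- As a difference of Kronecker deltas the incidence matrix needs no case for loops, whose two
  -- terms cancel, and its row sums split.
  ξ : (s t : Fin m → Fin n) → Fin m → Fin n → Carrier
  ξ s t e v = δ v (s e) + - δ v (t e)

  ξ-≢ : (s t : Fin m → Fin n) (e : Fin m) {v : Fin n} → v ≢ s e → v ≢ t e → ξ s t e v ≈ 0#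
  ξ-≢ s t e v≢s v≢t = trans (+-cong (reflexive (δ-≢ v≢s)) (-‿cong (reflexive (δ-≢ v≢t)))) (-‿inverseʳ 0#)

  ξ-source : (s t : Fin m → Fin n) (e : Fin m) → s e ≢ t e → ξ s t e (s e) ≈ 1#
  ξ-source s t e s≢t = trans
    (+-cong (reflexive (δ-≡ {i = s e} ≡.refl)) (trans (-‿cong (reflexive (δ-≢ s≢t))) -0#≈0#))
    (+-identityʳ 1#)

  sum-ξ : (s t : Fin m → Fin n) (e : Fin m) → sum (ξ s t e) ≈ 0#
  sum-ξ s t e = begin
    sum (ξ s t e)
      ≈⟨ ∑-distrib-+ (λ v → δ v (s e)) (λ v → - δ v (t e)) ⟩
    sum (λ v → δ v (s e)) + sum (λ v → - δ v (t e))
      ≈⟨ +-congˡ (sum-neg (λ v → δ v (t e))) ⟩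
    sum (λ v → δ v (s e)) + - sum (λ v → δ v (t e))
      ≈⟨ +-cong (sum-δ (s e)) (-‿cong (sum-δ (t e))) ⟩
    1# + - 1#
      ≈⟨ -‿inverseʳ 1# ⟩
    0# ∎

  -- M_G with no column of the incidence matrix deleted, for edges of
  -- weights a running from s to t.
  L : (a : Fin m → Carrier) (s t : Fin m → Fin n) → Fin m ⊎ Fin n → Fin m ⊎ Fin n → Carrier
  L a s t (inj₁ e) (inj₁ f) = if does (e ≟ f) then a e else 0#
  L a s t (inj₁ e) (inj₂ v) = ξ s t e v
  L a s t (inj₂ v) (inj₁ e) = - ξ s t e v
  L a s t (inj₂ v) (inj₂ w) = 0#

  L-diagonal : (a : Fin m → Carrier) (s t : Fin m → Fin n) (e : Fin m) →
    L a s t (inj₁ e) (inj₁ e) ≡ a e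
  L-diagonal a s t e rewrite dec-true (e ≟ e) ≡.refl = ≡.refl

  L-offDiagonal : (a : Fin m → Carrier) (s t : Fin m → Fin n) {e f : Fin m} → e ≢ f →
    L a s t (inj₁ e) (inj₁ f) ≡ 0#
  L-offDiagonal a s t {e} {f} e≢f rewrite dec-false (e ≟ f) e≢f = ≡.refl

  module _ (a : Fin m → Carrier) (s t : Fin m → Fin n) where

    sum-L : ∀ x → sum (L a s t x ∘ inj₂) ≈ 0#
    sum-L (inj₁ e) = sum-ξ s t e
    sum-L (inj₂ v) = sum-zero {n} λ w → refl

    sum-Lᵀ : ∀ x → sum (flip (L a s t) x ∘ inj₂) ≈ 0#
    sum-Lᵀ (inj₁ e) = trans (sum-neg (ξ s t e)) (trans (-‿cong (sum-ξ s t e)) -0#≈0#)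
    sum-Lᵀ (inj₂ v) = sum-zero {n} λ w → refl

    -- The deleted vertex is missing from the rows as well as from the columns; the rows are treated
    -- as columns of the transpose, whose vertex columns also sum to zero.
    L-rebase : (I J : Subset m) (w w′ : Fin n) →
      Singular (L a s t) (Kept I w) (Kept J w) → Singular (L a s t) (Kept I w′) (Kept J w′)
    L-rebase I J w w′ sing = singular-transpose (singular-rebase I w w′ sum-Lᵀ
      (singular-transpose (singular-rebase J w w′ sum-L sing)))

    -- The pivots are 1 at row `e` and column `s e`, then -1 at row `s e` and column `e`. Rows thus
    -- lose `e` first and columns lose `s e` first, whence the two orders in the conclusion.
    L-pivot : (I J : Subset m) (e : Fin m) → e ∉ I → e ∉ J → s e ≢ t e → a e ≈ 0# →
      Singular (L a s t) (Kept I (t e)) (Kept J (t e)) →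
      Singular (L a s t) (Kept I (t e) - inj₁ e - inj₂ (s e)) (Kept J (t e) - inj₂ (s e) - inj₁ e)
    L-pivot I J e e∉I e∉J s≢t a≈0 sing =
      singular-transpose (singular-pivot
        (singular-transpose (singular-pivot sing e∉I (inj₁-≟ e) s≢t (inj₂-≟ (s e))
          (trans (*-cong unit unit) (*-identityˡ 1#)) row))
        (e∉J , λ ()) (inj₁-≟ e) (s≢t , λ ()) (inj₂-≟ (s e))
        (trans (*-cong (-‿cong unit) (-‿cong unit)) (trans (-1*x≈-x (- 1#)) (-‿involutive 1#))) col)
      where
      unit : ξ s t e (s e) ≈ 1#
      unit = ξ-source s t e s≢t
      row : ∀ {z} → Kept J (t e) z → z ≢ inj₂ (s e) → L a s t (inj₁ e) z ≈ 0#
      row {inj₁ f} f∉J _ with e ≟ f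
      ... | yes _ = a≈0
      ... | no  _ = refl
      row {inj₂ v} v≢t v≢s = ξ-≢ s t e (v≢s ∘ ≡.cong inj₂) v≢t
      col : ∀ {z} → (Kept I (t e) - inj₁ e) z → z ≢ inj₂ (s e) → L a s t z (inj₁ e) ≈ 0#
      col {inj₁ f} (_ , f≢e) _   = reflexive (L-offDiagonal a s t (f≢e ∘ ≡.cong inj₁))
      col {inj₂ v} (v≢t , _) v≢s = trans (-‿cong (ξ-≢ s t e (v≢s ∘ ≡.cong inj₂) v≢t)) -0#≈0#

  -- Reversing an edge negates its row and its column: incidence entries change sign once, the
  -- diagonal entry twice, and `ε e * ε e ≈ 1#` restores the latter. Incidence entries are compared
  -- only at kept vertices, because a contraction alters them at the merged vertex.
  L-relabel : {a : Fin m → Carrier} {s t : Fin m → Fin n} {a′ : Fin m′ → Carrier} {s′ t′ : Fin m′ → Fin n′}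
    {ι : Fin m′ → Fin m} {σ : Fin n′ → Fin n} {P Q : Fin m ⊎ Fin n → Set} {P′ Q′ : Fin m′ ⊎ Fin n′ → Set}
    (ε : Fin m′ → Carrier) → (∀ e → ε e * ε e ≈ 1#) →
    Onto (Sum.map ι σ) P′ P → Onto (Sum.map ι σ) Q′ Q → (∀ e → a′ e ≈ a (ι e)) →
    (∀ e {v} → P′ (inj₂ v) ⊎ Q′ (inj₂ v) → ξ s′ t′ e v ≈ ε e * ξ s t (ι e) (σ v)) →
    Singular (L a s t) P Q → Singular (L a′ s′ t′) P′ Q′
  L-relabel {a = a} {s} {t} {a′} {s′} {t′} {ι} {σ} {P′ = P′} {Q′} ε ε² Φ Ψ a≈ ξ≈ sing =
    singular-relabel {M = L a s t} sing Φ Ψ η η entry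
    where
    η : Fin _ ⊎ Fin _ → Carrier
    η = Sum.[ ε , (λ _ → 1#) ]
    entry : ∀ {x y} → P′ x → Q′ y → L a′ s′ t′ x y ≈ η x * L a s t (Sum.map ι σ x) (Sum.map ι σ y) * η y
    entry {inj₁ e} {inj₁ f} _ _ with e ≟ f
    ... | yes ≡.refl = trans (a≈ e) (trans (sym (trans (*-congʳ (ε² e)) (*-identityˡ (a (ι e)))))
            (trans (trans (*-assoc _ _ _) (trans (*-congˡ (*-comm _ _)) (sym (*-assoc _ _ _))))
              (*-congʳ (*-congˡ (reflexive (≡.sym (L-diagonal a s t (ι e))))))))
    ... | no  e≢f    = sym (trans (*-congʳ (trans
            (*-congˡ (reflexive (L-offDiagonal a s t (e≢f ∘ inj₁-injective ∘ φ-injective Φ ∘ ≡.cong inj₁))))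
            (zeroʳ (ε e)))) (zeroˡ (ε f)))
    entry {inj₁ e} {inj₂ v} _ q = trans (ξ≈ e (inj₂ q)) (sym (*-identityʳ _))
    entry {inj₂ v} {inj₁ e} p _ = trans (-‿cong (ξ≈ e (inj₁ p)))
      (trans (trans (-‿distribʳ-* (ε e) (ξ s t (ι e) (σ v))) (*-comm _ _)) (*-congʳ (sym (*-identityˡ _))))
    entry {inj₂ v} {inj₂ w} _ _ = sym (trans (*-congʳ (zeroʳ 1#)) (zeroˡ 1#))

  ξ-reorient : {s t : Fin m → Fin n} {s′ t′ : Fin m′ → Fin n′} {σ : Fin n′ → Fin n} {e : Fin m} {e′ : Fin m′} →
    Injective _≡_ _≡_ σ → (s e , t e) ≈ₚ (σ (s′ e′) , σ (t′ e′)) →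
    ∃ λ ε → ε * ε ≈ 1# × ∀ v → ξ s′ t′ e′ v ≈ ε * ξ s t e (σ v)
  ξ-reorient {s = s} {t} {σ = σ} {e} σ-inj (inj₁ eq) = 1# , *-identityˡ 1# , λ v → trans
    (reflexive (≡.cong₂ (λ i j → i + - j) (δ-image v (≡.cong proj₁ eq)) (δ-image v (≡.cong proj₂ eq))))
    (sym (*-identityˡ (ξ s t e (σ v))))
    where
    δ-image : ∀ v {i j} → j ≡ σ i → δ v i ≡ δ (σ v) j
    δ-image v ≡.refl = δ-⇔ (≡.cong σ) σ-inj
  ξ-reorient {s = s} {t} {σ = σ} {e} σ-inj (inj₂ eq) =
    - 1# , trans (-1*x≈-x (- 1#)) (-‿involutive 1#) , λ v → trans
    (reflexive (≡.cong₂ (λ i j → i + - j) (δ-image v (≡.cong proj₂ eq)) (δ-image v (≡.cong proj₁ eq))))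
    (sym (trans (-1*x≈-x (ξ s t e (σ v))) (⁻¹-anti-homo‿- (δ (σ v) (s e)) (δ (σ v) (t e)))))
    where
    δ-image : ∀ v {i j} → j ≡ σ i → δ v i ≡ δ (σ v) j
    δ-image v ≡.refl = δ-⇔ (≡.cong σ) σ-inj

  L-relabel⁺ : {a : Fin m → Carrier} {s t : Fin m → Fin n} {a′ : Fin m′ → Carrier} {s′ t′ : Fin m′ → Fin n′}
    {ι : Fin m′ → Fin m} {σ : Fin n′ → Fin n} {P Q : Fin m ⊎ Fin n → Set} {P′ Q′ : Fin m′ ⊎ Fin n′ → Set} →
    Onto (Sum.map ι σ) P′ P → Onto (Sum.map ι σ) Q′ Q → (∀ e → a′ e ≡ a (ι e)) →
    (∀ e {v} → P′ (inj₂ v) ⊎ Q′ (inj₂ v) → ξ s′ t′ e v ≡ ξ s t (ι e) (σ v)) →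
    Singular (L a s t) P Q → Singular (L a′ s′ t′) P′ Q′
  L-relabel⁺ Φ Ψ a≡ ξ≡ = L-relabel (λ _ → 1#) (λ _ → *-identityˡ 1#) Φ Ψ (reflexive ∘ a≡)
    λ e p → trans (reflexive (ξ≡ e p)) (sym (*-identityˡ _))

open ≡ using (refl; sym; trans; cong; cong₂; subst; module ≡-Reasoning)

-- Polynomials form a commutative ring

infixl 6 _⊕_

_⊕_ : ∀ {m} → Monomial m → Monomial m → Monomial m
_⊕_ = zipWith ℕ._+_

𝟘 : ∀ {m} → Monomial m
𝟘 = replicate _ 0

⊕-identityˡ : ∀ {m} (μ : Monomial m) → 𝟘 ⊕ μ ≡ μ
⊕-identityˡ = Vec.zipWith-identityˡ ℕ.+-identityˡ

⊕-cancelˡ : ∀ {m} (μ : Monomial m) → Injective _≡_ _≡_ (μ ⊕_)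
⊕-cancelˡ Vec.[]      {Vec.[]}    {Vec.[]}    eq = refl
⊕-cancelˡ (a Vec.∷ μ) {b Vec.∷ ν} {c Vec.∷ ρ} eq =
  cong₂ Vec._∷_ (ℕ.+-cancelˡ-≡ a b c (cong Vec.head eq)) (⊕-cancelˡ μ (cong Vec.tail eq))

term : ∀ {m} → ℤ × Monomial m → Monomial m → ℤ
term (a , ν) μ = if does (Vec.≡-dec ℕ._≟_ ν μ) then a else 0ℤ

module _ {m : ℕ} where

  coeff-++ : (p q : Poly m) (μ : Monomial m) → coeff (p ++ q) μ ≡ coeff p μ ℤ.+ coeff q μ
  coeff-++ []            q μ = sym (ℤ.+-identityˡ _)
  coeff-++ ((a , ν) ∷ p) q μ = trans
    (cong (ℤ._+_ (term (a , ν) μ)) (coeff-++ p q μ)) (sym (ℤ.+-assoc (term (a , ν) μ) (coeff p μ) (coeff q μ)))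

  module _ {m′ : ℕ} {f : Monomial m → Monomial m′} {h : ℤ → ℤ} where

    -- Negation, multiplication by a term and substitution all act term by term, through an
    -- injective map of monomials and an additive map of coefficients. Injectivity keeps distinct
    -- monomials from being merged.
    coeff-map : Injective _≡_ _≡_ f → h 0ℤ ≡ 0ℤ → (∀ a b → h (a ℤ.+ b) ≡ h a ℤ.+ h b) →
      ∀ p μ → coeff (List.map (Product.map h f) p) (f μ) ≡ h (coeff p μ)
    coeff-map f-inj h-0 h-+ []            μ = sym h-0
    coeff-map f-inj h-0 h-+ ((a , ν) ∷ p) μ = trans
      (cong₂ ℤ._+_ term-map (coeff-map f-inj h-0 h-+ p μ)) (sym (h-+ _ (coeff p μ)))
      where
      term-map : term (h a , f ν) (f μ) ≡ h (term (a , ν) μ)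
      term-map with Vec.≡-dec ℕ._≟_ ν μ
      ... | yes ν≡μ rewrite dec-true (Vec.≡-dec ℕ._≟_ (f ν) (f μ)) (cong f ν≡μ) = refl
      ... | no  ν≢μ rewrite dec-false (Vec.≡-dec ℕ._≟_ (f ν) (f μ)) (ν≢μ ∘ f-inj) = sym h-0

    coeff-map-∉ : ∀ {μ} → (∀ ν → f ν ≢ μ) → ∀ p → coeff (List.map (Product.map h f) p) μ ≡ 0ℤ
    coeff-map-∉     f≢μ []            = refl
    coeff-map-∉ {μ} f≢μ ((a , ν) ∷ p)
      rewrite dec-false (Vec.≡-dec ℕ._≟_ (f ν) μ) (f≢μ ν) = trans (ℤ.+-identityˡ _) (coeff-map-∉ f≢μ p)

  open RawRing (polyRing m) using (_+_; _*_; -_; 0#; 1#)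

  ++-cong : {p p′ q q′ : Poly m} → p ≋ p′ → q ≋ q′ → p ++ q ≋ p′ ++ q′
  ++-cong {p} {p′} {q} {q′} eq eq′ μ =
    trans (coeff-++ p q μ) (trans (cong₂ ℤ._+_ (eq μ) (eq′ μ)) (sym (coeff-++ p′ q′ μ)))

  coeff-neg : (p : Poly m) (μ : Monomial m) → coeff (- p) μ ≡ ℤ.- coeff p μ
  coeff-neg = coeff-map id refl ℤ.neg-distrib-+

  -- `ν` divides `μ` exactly if adding `ν` to the truncated difference gives `μ` back. Then the
  -- coefficient at `μ` is `a` times the one at the quotient; otherwise no term of either product
  -- has monomial `μ`.
  mulTerm-cong : ∀ x {p q : Poly m} → p ≋ q → List.map (mulTerm x) p ≋ List.map (mulTerm x) q
  mulTerm-cong (a , ν) {p} {q} eq μ with Vec.≡-dec ℕ._≟_ (ν ⊕ zipWith ℕ._∸_ μ ν) μ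
  ... | yes ν+ρ≡μ rewrite sym ν+ρ≡μ = trans (shift p _) (trans (cong (a ℤ.*_) (eq _)) (sym (shift q _)))
    where shift = coeff-map (⊕-cancelˡ ν) (ℤ.*-zeroʳ a) (ℤ.*-distribˡ-+ a)
  ... | no  ν+ρ≢μ = trans (coeff-map-∉ ν+≢μ p) (sym (coeff-map-∉ ν+≢μ q))
    where
    subtract : ∀ {k} (ν ρ : Monomial k) → zipWith ℕ._∸_ (ν ⊕ ρ) ν ≡ ρ
    subtract Vec.[]      Vec.[]      = refl
    subtract (a Vec.∷ ν) (b Vec.∷ ρ) = cong₂ Vec._∷_ (ℕ.m+n∸m≡n a b) (subtract ν ρ)
    ν+≢μ : ∀ ρ → ν ⊕ ρ ≢ μ
    ν+≢μ ρ refl = ν+ρ≢μ (cong (ν ⊕_) (subtract ν ρ))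

  mulTerm-comm : ∀ x y → mulTerm {m} x y ≡ mulTerm y x
  mulTerm-comm (a , μ) (b , ν) = cong₂ _,_ (ℤ.*-comm a b) (Vec.zipWith-comm ℕ.+-comm μ ν)

  mulTerm-assoc : ∀ x y z → mulTerm {m} (mulTerm x y) z ≡ mulTerm x (mulTerm y z)
  mulTerm-assoc (a , μ) (b , ν) (c , ρ) = cong₂ _,_ (ℤ.*-assoc a b c) (Vec.zipWith-assoc ℕ.+-assoc μ ν ρ)

  ≡⇒≋ : {p q : Poly m} → p ≡ q → p ≋ q
  ≡⇒≋ refl μ = refl

  *-congˡ : (p : Poly m) {q r : Poly m} → q ≋ r → p * q ≋ p * r
  *-congˡ []      eq μ = refl
  *-congˡ (x ∷ p) {q} {r} eq = ++-cong {List.map (mulTerm x) q} {List.map (mulTerm x) r}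
    (mulTerm-cong x {q} {r} eq) (*-congˡ p {q} {r} eq)

  -- The product is defined by recursion on its left factor; commutativity needs the recursion on
  -- the right one, which holds only up to the order of the terms.
  *-cons : (p : Poly m) (x : ℤ × Monomial m) (q : Poly m) → p * (x ∷ q) ≋ List.map (mulTerm x) p ++ p * q
  *-cons []      x q μ = refl
  *-cons (y ∷ p) x q μ = trans (cong (λ z → coeff (z ∷ (yq ++ p * (x ∷ q))) μ) (mulTerm-comm y x))
    (cong (ℤ._+_ (term (mulTerm x y) μ)) (begin
    coeff (yq ++ p * (x ∷ q)) μ                ≡⟨ coeff-++ yq (p * (x ∷ q)) μ ⟩
    coeff yq μ ℤ.+ coeff (p * (x ∷ q)) μ
      ≡⟨ cong (ℤ._+_ (coeff yq μ)) (trans (*-cons p x q μ) (coeff-++ xp (p * q) μ)) ⟩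
    coeff yq μ ℤ.+ (coeff xp μ ℤ.+ coeff (p * q) μ)
      ≡⟨ x∙yz≈y∙xz (coeff yq μ) (coeff xp μ) (coeff (p * q) μ) ⟩
    coeff xp μ ℤ.+ (coeff yq μ ℤ.+ coeff (p * q) μ)
      ≡⟨ cong (ℤ._+_ (coeff xp μ)) (coeff-++ yq (p * q) μ) ⟨
    coeff xp μ ℤ.+ coeff (yq ++ p * q) μ       ≡⟨ coeff-++ xp (yq ++ p * q) μ ⟨
    coeff (xp ++ (yq ++ p * q)) μ              ∎))
    where
    open ≡-Reasoning
    yq = List.map (mulTerm y) q
    xp = List.map (mulTerm x) p

  *-comm : (p q : Poly m) → p * q ≋ q * p
  *-comm []      q μ = cong (λ r → coeff r μ) (sym (List.cartesianProductWith-zeroʳ mulTerm q))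
  *-comm (x ∷ p) q μ = trans
    (++-cong {List.map (mulTerm x) q} {List.map (mulTerm x) q} {p * q} {q * p} (λ _ → refl) (*-comm p q) μ)
    (sym (*-cons q x p μ))

  *-cong : {p p′ q q′ : Poly m} → p ≋ p′ → q ≋ q′ → p * q ≋ p′ * q′
  *-cong {p} {p′} {q} {q′} eq eq′ μ = begin
    coeff (p * q) μ    ≡⟨ *-congˡ p {q} {q′} eq′ μ ⟩
    coeff (p * q′) μ   ≡⟨ *-comm p q′ μ ⟩
    coeff (q′ * p) μ   ≡⟨ *-congˡ q′ {p} {p′} eq μ ⟩
    coeff (q′ * p′) μ  ≡⟨ *-comm q′ p′ μ ⟩
    coeff (p′ * q′) μ  ∎
    where open ≡-Reasoning

  *-assoc : (p q r : Poly m) → (p * q) * r ≡ p * (q * r)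
  *-assoc []      q r = refl
  *-assoc (x ∷ p) q r = trans (List.cartesianProductWith-distribʳ-++ mulTerm (List.map (mulTerm x) q) (p * q) r)
    (cong₂ _++_ (mulTerm-* q) (*-assoc p q r))
    where
    mulTerm-* : ∀ q → List.map (mulTerm x) q * r ≡ List.map (mulTerm x) (q * r)
    mulTerm-* []      = refl
    mulTerm-* (y ∷ q) = trans
      (cong₂ _++_ (trans (List.map-cong (mulTerm-assoc x y) r) (List.map-∘ r)) (mulTerm-* q))
      (sym (List.map-++ (mulTerm x) (List.map (mulTerm y) r) (q * r)))

  *-identityˡ : (p : Poly m) → 1# * p ≡ p
  *-identityˡ p = trans (List.++-identityʳ _)
    (trans (List.map-cong (λ (a , μ) → cong₂ _,_ (ℤ.*-identityˡ a) (⊕-identityˡ μ)) p) (List.map-id p))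

  *-distribʳ-++ : (p q r : Poly m) → (q ++ r) * p ≡ q * p ++ r * p
  *-distribʳ-++ p q r = List.cartesianProductWith-distribʳ-++ mulTerm q r p

polyCommutativeRing : ℕ → CommutativeRing 0ℓ 0ℓ
polyCommutativeRing m = record
  { RawRing (polyRing m)
  ; isCommutativeRing = record
    { isRing = record
      { +-isAbelianGroup = record
        { isGroup = record
          { isMonoid = record
            { isSemigroup = record
              { isMagma = record
                { isEquivalence = record
                  { refl  = λ μ → refl
                  ; sym   = λ eq μ → sym (eq μ)
                  ; trans = λ eq eq′ μ → trans (eq μ) (eq′ μ)
                  }
                ; ∙-cong = λ {p} {p′} → ++-cong {m} {p} {p′}
                }
              ; assoc = λ p q r → ≡⇒≋ (List.++-assoc p q r)
              }
            ; identity = (λ p μ → refl) , λ p → ≡⇒≋ (List.++-identityʳ p)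
            }
          ; inverse = (λ p μ → trans (coeff-++ (- p) p μ)
                        (trans (cong (ℤ._+ coeff p μ) (coeff-neg p μ)) (ℤ.+-inverseˡ (coeff p μ))))
                    , (λ p μ → trans (coeff-++ p (- p) μ)
                        (trans (cong (ℤ._+_ (coeff p μ)) (coeff-neg p μ)) (ℤ.+-inverseʳ (coeff p μ))))
          ; ⁻¹-cong = λ {p} {q} eq μ → trans (coeff-neg p μ) (trans (cong ℤ.-_ (eq μ)) (sym (coeff-neg q μ)))
          }
        ; comm = λ p q μ → trans (coeff-++ p q μ)
            (trans (ℤ.+-comm (coeff p μ) (coeff q μ)) (sym (coeff-++ q p μ)))
        }
      ; *-cong = λ {p} {p′} {q} {q′} → *-cong {m} {p} {p′} {q} {q′}
      ; *-assoc = λ p q r → ≡⇒≋ (*-assoc p q r)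
      ; *-identity = (λ p → ≡⇒≋ (*-identityˡ p)) , λ p μ → trans (*-comm p 1# μ) (≡⇒≋ (*-identityˡ p) μ)
      ; distrib = (λ p q r μ → trans (*-comm p (q ++ r) μ) (trans (≡⇒≋ (*-distribʳ-++ p q r) μ)
                     (++-cong {m} {q * p} {p * q} {r * p} {p * r} (*-comm q p) (*-comm r p) μ)))
                , λ p q r → ≡⇒≋ (*-distribʳ-++ p q r)
      }
    ; *-comm = *-comm
    }
  }
  where open RawRing (polyRing m) using (_*_; -_; 1#)

-- Ring homomorphisms induced by injective maps of monomials

record MonomialMap (m m′ : ℕ) : Set where
  field
    ⟦_⟧          : Monomial m → Monomial m′
    ⟦⟧-injective : Injective _≡_ _≡_ ⟦_⟧
    ⟦⟧-𝟘         : ⟦ 𝟘 ⟧ ≡ 𝟘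
    ⟦⟧-⊕         : ∀ μ ν → ⟦ μ ⊕ ν ⟧ ≡ ⟦ μ ⟧ ⊕ ⟦ ν ⟧

module Substitution {m m′} (f : MonomialMap m m′) where
  open MonomialMap f
  private
    module P = RawRing (polyRing m)
    module P′ = RawRing (polyRing m′)
    module D = DeterminantProperties (polyCommutativeRing m)
    module D′ = DeterminantProperties (polyCommutativeRing m′)

  Φ : Poly m → Poly m′
  Φ = List.map (Product.map₂ ⟦_⟧)

  coeff-Φ : ∀ p μ → coeff (Φ p) ⟦ μ ⟧ ≡ coeff p μ
  coeff-Φ = coeff-map ⟦⟧-injective refl λ _ _ → refl

  Φ-injective₀ : ∀ p → Φ p ≋ [] → p ≋ []
  Φ-injective₀ p Φp≋0 μ = trans (sym (coeff-Φ p μ)) (Φp≋0 ⟦ μ ⟧)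

  Φ-constant : ∀ a → Φ (constant a) ≡ constant a
  Φ-constant a = cong (λ μ → (a , μ) ∷ []) ⟦⟧-𝟘

  Φ-++ : ∀ p q → Φ (p ++ q) ≡ Φ p ++ Φ q
  Φ-++ = List.map-++ _

  Φ-neg : ∀ p → Φ (P.- p) ≡ P′.- Φ p
  Φ-neg p = trans (sym (List.map-∘ p)) (List.map-∘ p)

  Φ-* : ∀ p q → Φ (p P.* q) ≡ Φ p P′.* Φ q
  Φ-* []            q = refl
  Φ-* ((a , μ) ∷ p) q = trans (Φ-++ (List.map (mulTerm (a , μ)) q) (p P.* q)) (cong₂ _++_
    (trans (sym (List.map-∘ q))
      (trans (List.map-cong (λ (b , ν) → cong (a ℤ.* b ,_) (⟦⟧-⊕ μ ν)) q) (List.map-∘ q)))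
    (Φ-* p q))

  Φ-sum : ∀ {k} (g : Fin k → Poly m) → Φ (D.sum g) ≡ D′.sum (Φ ∘ g)
  Φ-sum {zero}  g = refl
  Φ-sum {suc k} g = trans (Φ-++ (g zero) (D.sum (g ∘ suc))) (cong (Φ (g zero) ++_) (Φ-sum (g ∘ suc)))

  Φ-sgn : ∀ {k} (j : Fin k) → Φ (D.sgn j) ≡ D′.sgn j
  Φ-sgn zero    = Φ-constant 1ℤ
  Φ-sgn (suc j) = trans (Φ-* (P.- P.1#) (D.sgn j))
    (cong₂ P′._*_ (trans (Φ-neg P.1#) (cong P′.-_ (Φ-constant 1ℤ))) (Φ-sgn j))

  -- The ring operations are list operations and `Φ` acts on each term separately, so it commutes
  -- with them up to `≡` and not merely up to `≋`.
  Φ-det : ∀ {k} (M : Matrix (Poly m) k) → Φ (D.det M) ≡ D′.det (λ r c → Φ (M r c))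
  Φ-term : ∀ {k} (M : Matrix (Poly m) (suc k)) j →
    Φ ((D.sgn j P.* M zero j) P.* D.det (λ r c → M (suc r) (punchIn j c)))
    ≡ (D′.sgn j P′.* Φ (M zero j)) P′.* D′.det (λ r c → Φ (M (suc r) (punchIn j c)))

  Φ-det {zero}  M = Φ-constant 1ℤ
  Φ-det {suc k} M = trans (Φ-sum λ j → (D.sgn j P.* M zero j) P.* D.det (λ r c → M (suc r) (punchIn j c)))
    (D′.sum-cong-≗ (Φ-term M))

  Φ-term M j = trans (Φ-* (D.sgn j P.* M zero j) _) (cong₂ P′._*_
    (trans (Φ-* (D.sgn j) (M zero j)) (cong (P′._* Φ (M zero j)) (Φ-sgn j)))
    (Φ-det λ r c → M (suc r) (punchIn j c)))

tabulate-insertAt : ∀ {m} (g : Fin (suc m) → ℕ) (e : Fin (suc m)) →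
  tabulate g ≡ insertAt (tabulate (g ∘ punchIn e)) e (g e)
tabulate-insertAt         g zero    = refl
tabulate-insertAt {suc m} g (suc e) = cong (g zero Vec.∷_) (tabulate-insertAt (g ∘ suc) e)

insertAt-⊕ : ∀ {m} (μ ν : Monomial m) (e : Fin (suc m)) (a b : ℕ) →
  insertAt (μ ⊕ ν) e (a ℕ.+ b) ≡ insertAt μ e a ⊕ insertAt ν e b
insertAt-⊕ μ           ν           zero    a b = refl
insertAt-⊕ (c Vec.∷ μ) (d Vec.∷ ν) (suc e) a b = cong (c ℕ.+ d Vec.∷_) (insertAt-⊕ μ ν e a b)

insertAt-𝟘 : ∀ {m} (e : Fin (suc m)) → insertAt 𝟘 e 0 ≡ 𝟘
insertAt-𝟘         zero    = refl
insertAt-𝟘 {suc m} (suc e) = cong (0 Vec.∷_) (insertAt-𝟘 e)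

exponents : ∀ {m} → Fin m → Fin m → ℕ
exponents i j = if does (i ≟ j) then 1 else 0

insertion : ∀ {m} → Fin (suc m) → MonomialMap m (suc m)
insertion e = record
  { ⟦_⟧       = λ μ → insertAt μ e 0
  ; ⟦⟧-injective = λ {μ} {ν} eq → trans (sym (Vec.removeAt-insertAt μ e 0))
      (trans (cong (λ ρ → Vec.removeAt ρ e) eq) (Vec.removeAt-insertAt ν e 0))
  ; ⟦⟧-𝟘      = insertAt-𝟘 e
  ; ⟦⟧-⊕      = λ μ ν → insertAt-⊕ μ ν e 0 0
  }

relabelling : ∀ {m} → Permutation′ m → MonomialMap m m
relabelling {m} π = record
  { ⟦_⟧       = relabel
  ; ⟦⟧-injective = λ {μ} {ν} eq → trans (sym (Vec.tabulate∘lookup μ)) (trans (Vec.tabulate-cong λ i →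
      trans (sym (lookup-relabel μ i)) (trans (cong (λ ρ → lookup ρ (π ⟨$⟩ʳ i)) eq) (lookup-relabel ν i)))
      (Vec.tabulate∘lookup ν))
  ; ⟦⟧-𝟘      = trans
      (Vec.tabulate-cong λ i → trans (Vec.lookup-replicate (π ⟨$⟩ˡ i) 0) (sym (Vec.lookup-replicate i 0)))
      (Vec.tabulate∘lookup 𝟘)
  ; ⟦⟧-⊕      = λ μ ν → trans
      (Vec.tabulate-cong λ i → trans (Vec.lookup-zipWith ℕ._+_ (π ⟨$⟩ˡ i) μ ν)
        (trans (sym (cong₂ ℕ._+_ (Vec.lookup∘tabulate _ i) (Vec.lookup∘tabulate _ i)))
               (sym (Vec.lookup-zipWith ℕ._+_ i (relabel μ) (relabel ν)))))
      (Vec.tabulate∘lookup _)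
  }
  where
  relabel : Monomial m → Monomial m
  -- Reading exponents through the inverse of `π` sends the variable `i` to the variable `π ⟨$⟩ʳ i`.
  relabel μ = tabulate (lookup μ ∘ (π ⟨$⟩ˡ_))
  lookup-relabel : ∀ μ i → lookup (relabel μ) (π ⟨$⟩ʳ i) ≡ lookup μ i
  lookup-relabel μ i = trans (Vec.lookup∘tabulate _ (π ⟨$⟩ʳ i)) (cong (lookup μ) (Perm.inverseˡ π))

exponents-⇔ : ∀ {m m′} {i j : Fin m} {i′ j′ : Fin m′} → (i ≡ j → i′ ≡ j′) → (i′ ≡ j′ → i ≡ j) →
  exponents i j ≡ exponents i′ j′
exponents-⇔ {i = i} {j} {i′} {j′} to from = cong (if_then 1 else 0) (does-⇔ (mk⇔ to from) (i ≟ j) (i′ ≟ j′))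

Φ-var-relabelling : ∀ {m} (π : Permutation′ m) i →
  Substitution.Φ (relabelling π) (var i) ≡ var (π ⟨$⟩ʳ i)
Φ-var-relabelling π i = cong (λ μ → (1ℤ , μ) ∷ []) (Vec.tabulate-cong λ j →
  trans (Vec.lookup∘tabulate (exponents i) (π ⟨$⟩ˡ j))
    (exponents-⇔ {i = i} {π ⟨$⟩ˡ j} {π ⟨$⟩ʳ i} {j}
      (λ { refl → Perm.inverseʳ π }) (λ { refl → sym (Perm.inverseˡ π) })))

-- Separating the powers of one variable

module Peeling {m} (e : Fin (suc m)) where
  open Substitution (insertion e) public
  private
    R  = polyCommutativeRing m
    R′ = polyCommutativeRing (suc m)
    module R = CommutativeRing R
    module R′ = CommutativeRing R′
    module D = DeterminantProperties R
    module D′ = DeterminantProperties R′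

  Φ-var-punchIn : ∀ i → Φ (var i) ≡ var (punchIn e i)
  Φ-var-punchIn i = cong (λ μ → (1ℤ , μ) ∷ []) (sym (trans (tabulate-insertAt (exponents (punchIn e i)) e)
    (cong₂ (λ μ → insertAt μ e)
      (Vec.tabulate-cong λ j → exponents-⇔ (punchIn-injective e i j) (cong (punchIn e)))
      (cong (if_then 1 else 0) (dec-false (punchIn e i ≟ e) (punchInᵢ≢i e i))))))

  insertAt₁ : (μ : Monomial m) → tabulate (exponents e) ⊕ insertAt μ e 0 ≡ insertAt μ e 1
  insertAt₁ μ = begin
    tabulate (exponents e) ⊕ insertAt μ e 0
      ≡⟨ cong (_⊕ insertAt μ e 0) (trans (tabulate-insertAt (exponents e) e)
           (cong₂ (λ μ → insertAt μ e) (trans (Vec.tabulate-cong λ j →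
               trans (cong (if_then 1 else 0) (dec-false (e ≟ punchIn e j) (punchInᵢ≢i e j ∘ sym)))
                     (sym (Vec.lookup-replicate j 0)))
               (Vec.tabulate∘lookup 𝟘))
             (cong (if_then 1 else 0) (dec-true (e ≟ e) refl)))) ⟩
    insertAt 𝟘 e 1 ⊕ insertAt μ e 0
      ≡⟨ insertAt-⊕ 𝟘 μ e 1 0 ⟨
    insertAt (𝟘 ⊕ μ) e 1
      ≡⟨ cong (λ μ → insertAt μ e 1) (⊕-identityˡ μ) ⟩
    insertAt μ e 1 ∎
    where open ≡-Reasoning

  insertAt-lookup : ∀ (μ ν : Monomial m) {a b} → insertAt μ e a ≡ insertAt ν e b → a ≡ b
  insertAt-lookup μ ν {a} {b} eq = trans (sym (Vec.insertAt-lookup μ e a))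
    (trans (cong (λ ρ → lookup ρ e) eq) (Vec.insertAt-lookup ν e b))

  var-*-Φ : ∀ p → var e R′.* Φ p ≡ List.map (Product.map (1ℤ ℤ.*_) (λ μ → insertAt μ e 1)) p
  var-*-Φ p = trans (List.++-identityʳ _) (trans (sym (List.map-∘ p))
    (List.map-cong (λ (a , μ) → cong (1ℤ ℤ.* a ,_) (insertAt₁ μ)) p))

  -- α_e Φ p has degree one in α_e and Φ q has degree zero.
  separate : ∀ p q → var e R′.* Φ p R′.+ Φ q ≋ [] → p ≋ [] × q ≋ []
  separate p q eq = (λ μ → begin
      coeff p μ
        ≡⟨ ℤ.*-identityˡ _ ⟨
      1ℤ ℤ.* coeff p μ
        ≡⟨ coeff-map injective₁ (ℤ.*-zeroʳ 1ℤ) (ℤ.*-distribˡ-+ 1ℤ) p μ ⟨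
      coeff (List.map (Product.map (1ℤ ℤ.*_) (λ μ → insertAt μ e 1)) p) (insertAt μ e 1)
        ≡⟨ cong (λ r → coeff r (insertAt μ e 1)) (var-*-Φ p) ⟨
      coeff (var e R′.* Φ p) (insertAt μ e 1)
        ≡⟨ ℤ.+-identityʳ _ ⟨
      coeff (var e R′.* Φ p) (insertAt μ e 1) ℤ.+ 0ℤ
        ≡⟨ cong (ℤ._+_ (coeff (var e R′.* Φ p) (insertAt μ e 1)))
             (coeff-map-∉ (λ ν eq → contradiction (insertAt-lookup ν μ eq) λ ()) q) ⟨
      coeff (var e R′.* Φ p) (insertAt μ e 1) ℤ.+ coeff (Φ q) (insertAt μ e 1)
        ≡⟨ coeff-++ (var e R′.* Φ p) (Φ q) (insertAt μ e 1) ⟨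
      coeff (var e R′.* Φ p R′.+ Φ q) (insertAt μ e 1)
        ≡⟨ eq (insertAt μ e 1) ⟩
      0ℤ ∎)
    , λ μ → begin
      coeff q μ
        ≡⟨ coeff-Φ q μ ⟨
      coeff (Φ q) (insertAt μ e 0)
        ≡⟨ ℤ.+-identityˡ _ ⟨
      0ℤ ℤ.+ coeff (Φ q) (insertAt μ e 0)
        ≡⟨ cong (ℤ._+ coeff (Φ q) (insertAt μ e 0)) (trans (cong (λ r → coeff r (insertAt μ e 0)) (var-*-Φ p))
             (coeff-map-∉ (λ ν eq → contradiction (insertAt-lookup ν μ eq) λ ()) p)) ⟨
      coeff (var e R′.* Φ p) (insertAt μ e 0) ℤ.+ coeff (Φ q) (insertAt μ e 0)
        ≡⟨ coeff-++ (var e R′.* Φ p) (Φ q) (insertAt μ e 0) ⟨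
      coeff (var e R′.* Φ p R′.+ Φ q) (insertAt μ e 0)
        ≡⟨ eq (insertAt μ e 0) ⟩
      0ℤ ∎
    where
    open ≡-Reasoning
    injective₁ : Injective _≡_ _≡_ (λ μ → insertAt μ e 1)
    injective₁ {μ} {ν} eq = trans (sym (Vec.removeAt-insertAt μ e 1))
      (trans (cong (λ ρ → Vec.removeAt ρ e) eq) (Vec.removeAt-insertAt ν e 1))

  -- With the variable confined to the corner, `det M` is `var e` times the image of the corner
  -- minor plus the image of the other terms, so both vanish by `separate`. The corner of `B` is
  -- zero, and hence `det B` consists of those other terms.
  det-peel : ∀ {k} (M : Matrix (Poly (suc m)) (suc k)) (B : Matrix (Poly m) (suc k)) →
    M zero zero ≋ var e → B zero zero ≋ [] →
    (∀ j → M zero (suc j) ≋ Φ (B zero (suc j))) → (∀ i c → M (suc i) c ≋ Φ (B (suc i) c)) →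
    D′.det M ≋ [] →
    D.det (λ r c → B (suc r) (suc c)) ≋ [] × D.det B ≋ []
  det-peel {k} M B M₀₀ B₀₀ M₀ M₁ M≋0 = proj₁ separated , λ μ → trans
    (coeff-++ ((R.1# R.* B zero zero) R.* minor) rest μ)
    (cong₂ ℤ._+_ (D.*-zero {minor} {(R.1# R.* B zero zero) R.* minor} (R.1# R.* B zero zero)
      (R.refl {(R.1# R.* B zero zero) R.* minor}) (proj₁ separated) μ) (proj₂ separated μ))
    where
    open import Relation.Binary.Reasoning.Setoid R′.setoid
    minor = D.det (λ r c → B (suc r) (suc c))
    rest  = D.sum λ j → (D.sgn (suc j) R.* B zero (suc j)) R.* D.det λ r c → B (suc r) (punchIn (suc j) c)
    separated = separate minor rest (begin
      var e R′.* Φ minor R′.+ Φ rest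
        ≡⟨ cong₂ (λ p q → var e R′.* p R′.+ q) (Φ-det (λ r c → B (suc r) (suc c)))
             (trans (Φ-sum λ j → (D.sgn (suc j) R.* B zero (suc j))
                                   R.* D.det λ r c → B (suc r) (punchIn (suc j) c))
                    (D′.sum-cong-≗ λ j → Φ-term B (suc j))) ⟩
      var e R′.* D′.det (λ r c → Φ (B (suc r) (suc c)))
        R′.+ D′.sum (λ j → (D′.sgn (suc j) R′.* Φ (B zero (suc j)))
                             R′.* D′.det λ r c → Φ (B (suc r) (punchIn (suc j) c)))
        ≈⟨ D′.det-splitCorner M (λ r c → Φ (B r c)) {var e} M₀₀ M₀ M₁ ⟨
      D′.det M
        ≈⟨ M≋0 ⟩
      [] ∎)

-- Maps of edges and vertices: embeddings, permutations, the quotient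

preimage : ∀ {m M} → (Fin m → Fin M) → Subset M → Subset m
preimage ι p = tabulate (lookup p ∘ ι)

module _ {m M} {ι : Fin m → Fin M} {p : Subset M} where

  ∈-preimage⁺ : ∀ {x} → ι x ∈ p → x ∈ preimage ι p
  ∈-preimage⁺ {x} ιx∈p = Vec.lookup⇒[]= x _
    (trans (Vec.lookup∘tabulate (lookup p ∘ ι) x) (Vec.[]=⇒lookup ιx∈p))

  ∈-preimage⁻ : ∀ {x} → x ∈ preimage ι p → ι x ∈ p
  ∈-preimage⁻ {x} x∈ = Vec.lookup⇒[]= (ι x) p
    (trans (sym (Vec.lookup∘tabulate (lookup p ∘ ι) x)) (Vec.[]=⇒lookup x∈))

  does-∈-preimage : ∀ x → does (x ∈? preimage ι p) ≡ does (ι x ∈? p)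
  does-∈-preimage x = does-⇔ (mk⇔ ∈-preimage⁻ ∈-preimage⁺) (x ∈? preimage ι p) (ι x ∈? p)

module _ {m} (e : Fin (suc m)) where

  onto-∉ : (I : Subset (suc m)) → Onto (punchIn e) (_∉ preimage (punchIn e) I) ((_∉ I) - e)
  onto-∉ I = record
    { φ-injective = punchIn-injective e _ _
    ; into        = λ {x} x∉ → x∉ ∘ ∈-preimage⁺ , punchInᵢ≢i e x
    ; onto        = λ { (y∉I , y≢e) → let e≢y = y≢e ∘ sym in
        punchOut e≢y , (λ x∈ → y∉I (subst (_∈ I) (punchIn-punchOut e≢y) (∈-preimage⁻ x∈)))
        , punchIn-punchOut e≢y }
    }

permutation-injective : ∀ {k} (ρ : Permutation′ k) → Injective _≡_ _≡_ (ρ ⟨$⟩ʳ_)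
permutation-injective ρ eq =
  trans (sym (Perm.inverseˡ ρ)) (trans (cong (ρ ⟨$⟩ˡ_) eq) (Perm.inverseˡ ρ))

onto-permutation-∉ : ∀ {m} (π : Permutation′ m) (I : Subset m) →
  Onto (π ⟨$⟩ʳ_) (_∉ preimage (π ⟨$⟩ʳ_) I) (_∉ I)
onto-permutation-∉ π I = record
  { φ-injective = permutation-injective π
  ; into        = λ e∉ → e∉ ∘ ∈-preimage⁺
  ; onto        = λ {f} f∉ → π ⟨$⟩ˡ f , (λ f∈ → f∉ (subst (_∈ I) (Perm.inverseʳ π) (∈-preimage⁻ f∈)))
                        , Perm.inverseʳ π
  }

onto-permutation-≢ : ∀ {n} (σ : Permutation′ n) (w : Fin n) → Onto (σ ⟨$⟩ʳ_) (_≢ w) (_≢ σ ⟨$⟩ʳ w)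
onto-permutation-≢ σ w = record
  { φ-injective = permutation-injective σ
  ; into        = λ v≢w → v≢w ∘ permutation-injective σ
  ; onto        = λ {v} v≢w → σ ⟨$⟩ˡ v , (λ { refl → v≢w (sym (Perm.inverseʳ σ)) }) , Perm.inverseʳ σ
  }

module _ {n} (u v : Fin (suc (suc n))) (u≢v : u ≢ v) where

  private q = identify u v u≢v

  identify-punchIn : ∀ x → q (punchIn v x) ≡ x
  identify-punchIn x with v ≟ punchIn v x
  ... | yes eq = contradiction (sym eq) (punchInᵢ≢i v x)
  ... | no  v≢ = trans (punchOut-cong v refl) (punchOut-punchIn v)

  punchIn-identify : ∀ {z} → z ≢ v → punchIn v (q z) ≡ z
  punchIn-identify {z} z≢v with v ≟ z
  ... | yes v≡z = contradiction (sym v≡z) z≢v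
  ... | no  v≢z = punchIn-punchOut v≢z

  identify-target : q v ≡ q u
  identify-target with v ≟ v | v ≟ u
  ... | no v≢v | _       = contradiction refl v≢v
  ... | yes _  | yes v≡u = contradiction (sym v≡u) u≢v
  ... | yes _  | no  v≢u = punchOut-cong v refl

  -- Excluding the merged vertex in the quotient amounts to excluding both ends upstairs: the one
  -- that is the deleted column and the one removed by the pivots.
  onto-identify : Onto (punchIn v) (_≢ q u) (λ z → z ≢ u × z ≢ v)
  onto-identify = record
    { φ-injective = punchIn-injective v _ _
    ; into        = λ {x} x≢qu → (λ eq → x≢qu (trans (sym (identify-punchIn x)) (cong q eq))) , punchInᵢ≢i v x
    ; onto        = λ { {z} (z≢u , z≢v) → q z
        , (λ eq → z≢u (trans (sym (punchIn-identify z≢v)) (trans (cong (punchIn v) eq) (punchIn-identify u≢v))))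
        , punchIn-identify z≢v }
    }

  -- Fibres other than the merged one are single vertices, so Kronecker deltas, and with them
  -- incidence entries, are unchanged there.
  identify-fiber : ∀ {x z} → x ≢ q u → x ≡ q z → punchIn v x ≡ z
  identify-fiber {x} {z} x≢qu refl with toSum (z ≟ v)
  ... | inj₁ refl = contradiction identify-target x≢qu
  ... | inj₂ z≢v    = punchIn-identify z≢v

≈ₚ-sym : {A : Set} {p q : A × A} → p ≈ₚ q → q ≈ₚ p
≈ₚ-sym (inj₁ refl) = inj₁ refl
≈ₚ-sym (inj₂ refl) = inj₂ refl

≈ₚ-trans : {A : Set} {p q r : A × A} → p ≈ₚ q → q ≈ₚ r → p ≈ₚ r
≈ₚ-trans (inj₁ refl) eq            = eq
≈ₚ-trans (inj₂ refl) (inj₁ refl) = inj₂ refl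
≈ₚ-trans (inj₂ refl) (inj₂ refl) = inj₁ refl

≈ₚ-map : {A B : Set} (f : A → B) {p q : A × A} → p ≈ₚ q → Product.map f f p ≈ₚ Product.map f f q
≈ₚ-map f (inj₁ refl) = inj₁ refl
≈ₚ-map f (inj₂ refl) = inj₂ refl

≈ₚ-≢ : {A : Set} {p q : A × A} → p ≈ₚ q → proj₁ p ≢ proj₂ p → proj₁ q ≢ proj₂ q
≈ₚ-≢ (inj₁ refl) = id
≈ₚ-≢ (inj₂ refl) = _∘ sym

≈ₚ-avoid : {A : Set} {p q : A × A} → p ≈ₚ q → ∀ {z} → z ≢ proj₁ p × z ≢ proj₂ p → z ≢ proj₁ q × z ≢ proj₂ q
≈ₚ-avoid (inj₁ refl) = id
≈ₚ-avoid (inj₂ refl) = Product.swap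

-- Deletion, contraction and isomorphism on the level of `L`

module MinorMatrices (R : CommutativeRing 0ℓ 0ℓ) where
  open CommutativeRing R using (Carrier; _≈_; 0#; _+_; -_)
  open SingularMatrices R

  L-delete : ∀ {m n} {a : Fin (suc m) → Carrier} {a′ : Fin m → Carrier} {s t : Fin (suc m) → Fin n}
    (e : Fin (suc m)) (I J : Subset (suc m)) {w : Fin n} → (∀ f → a′ f ≡ a (punchIn e f)) →
    Singular (L a s t) (Kept I w - inj₁ e) (Kept J w - inj₁ e) →
    Singular (L a′ (s ∘ punchIn e) (t ∘ punchIn e))
      (Kept (preimage (punchIn e) I) w) (Kept (preimage (punchIn e) J) w)
  L-delete e I J {w} a≡ = L-relabel⁺ (kept I) (kept J) a≡ λ _ _ → refl
    where
    kept : ∀ I → Onto (Sum.map (punchIn e) id) (Kept (preimage (punchIn e) I) w) (Kept I w - inj₁ e)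
    kept I = onto-⇔
      (λ { {inj₁ f} (f∉I , f≢e) → f∉I , f≢e ∘ inj₁-injective ; {inj₂ v} v≢w → v≢w , λ () })
      (λ { {inj₁ f} (f∉I , f≢e) → f∉I , f≢e ∘ cong inj₁ ; {inj₂ v} (v≢w , _) → v≢w })
      (onto-⊎ (onto-∉ e I) onto-id)

  -- Moving the deleted column to t e makes the only nonzero entries of row e
  -- and column e those at s e; expanding along them leaves the matrix of the
  -- contracted graph.
  L-contract : ∀ {m n} {a : Fin (suc m) → Carrier} {a′ : Fin m → Carrier}
    {s t : Fin (suc m) → Fin (suc (suc n))} {u v : Fin (suc (suc n))} (u≢v : u ≢ v)
    (e : Fin (suc m)) (I J : Subset (suc m)) {w : Fin (suc (suc n))} →
    (s e , t e) ≈ₚ (u , v) → e ∉ I → e ∉ J → a e ≈ 0# → (∀ f → a′ f ≡ a (punchIn e f)) →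
    Singular (L a s t) (Kept I w) (Kept J w) →
    let q = identify u v u≢v in
    Singular (L a′ (q ∘ s ∘ punchIn e) (q ∘ t ∘ punchIn e))
      (Kept (preimage (punchIn e) I) (q u)) (Kept (preimage (punchIn e) J) (q u))
  L-contract {a = a} {s = s} {t} {u} {v} u≢v e I J {w} ends e∉I e∉J a≈0 a≡ sing =
    L-relabel⁺ {s = s} {t} {σ = punchIn v} rows columns a≡ ξ≡
      (L-pivot a s t I J e e∉I e∉J s≢t a≈0 (L-rebase a s t I J w (t e) sing))
    where
    q = identify u v u≢v
    s≢t : s e ≢ t e
    s≢t = ≈ₚ-≢ (≈ₚ-sym ends) u≢v
    δ-identify : ∀ {x z} → x ≢ q u → δ x (q z) ≡ δ (punchIn v x) z
    δ-identify x≢qu = δ-⇔ (identify-fiber u v u≢v x≢qu) λ { refl → sym (identify-punchIn u v u≢v _) }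
    Remaining : Subset _ → Fin _ ⊎ Fin _ → Set
    Remaining I = Sum.[ (_∉ I) - e , (λ z → z ≢ u × z ≢ v) ]
    kept : ∀ I → Onto (Sum.map (punchIn e) (punchIn v)) (Kept (preimage (punchIn e) I) (q u)) (Remaining I)
    kept I = onto-⊎ (onto-∉ e I) (onto-identify u v u≢v)
    to : ∀ I {x} → Remaining I x → Kept I (t e) x × x ≢ inj₂ (s e) × x ≢ inj₁ e
    to I {inj₁ f} (f∉I , f≢e) = f∉I , (λ ()) , f≢e ∘ inj₁-injective
    to I {inj₂ z} z≢          = let z≢s , z≢t = ≈ₚ-avoid (≈ₚ-sym ends) z≢ in z≢t , z≢s ∘ inj₂-injective , λ ()
    from : ∀ I {x} → Kept I (t e) x × x ≢ inj₂ (s e) × x ≢ inj₁ e → Remaining I x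
    from I {inj₁ f} (f∉I , _ , f≢e) = f∉I , f≢e ∘ cong inj₁
    from I {inj₂ z} (z≢t , z≢s , _) = ≈ₚ-avoid ends (z≢s ∘ cong inj₂ , z≢t)
    rows : Onto (Sum.map (punchIn e) (punchIn v)) (Kept (preimage (punchIn e) I) (q u))
                (Kept I (t e) - inj₁ e - inj₂ (s e))
    rows = onto-⇔ (λ p → let k , x≢s , x≢e = to I p in (k , x≢e) , x≢s)
                  (λ { ((k , x≢e) , x≢s) → from I (k , x≢s , x≢e) }) (kept I)
    columns : Onto (Sum.map (punchIn e) (punchIn v)) (Kept (preimage (punchIn e) J) (q u))
                   (Kept J (t e) - inj₂ (s e) - inj₁ e)
    columns = onto-⇔ (λ p → let k , x≢s , x≢e = to J p in (k , x≢s) , x≢e)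
                     (λ { ((k , x≢s) , x≢e) → from J (k , x≢s , x≢e) }) (kept J)
    ξ≡ : ∀ f {x} → x ≢ q u ⊎ x ≢ q u →
      ξ (q ∘ s ∘ punchIn e) (q ∘ t ∘ punchIn e) f x ≡ ξ s t (punchIn e f) (punchIn v x)
    ξ≡ f p = let x≢qu = Sum.[ id , id ] p in cong₂ (λ i j → i + - j) (δ-identify x≢qu) (δ-identify x≢qu)

  -- The deleted vertices `w` and `w′` are unrelated, so the former is first moved to the image of
  -- the latter. Differing orientations are absorbed by the edge signs of `ξ-reorient`.
  L-isomorphic : ∀ {m n} (a : Fin m → Carrier) (s t s′ t′ : Fin m → Fin n)
    (π : Permutation′ m) (σ : Permutation′ n) (I J : Subset m) (w w′ : Fin n) →
    (∀ e → (s (π ⟨$⟩ʳ e) , t (π ⟨$⟩ʳ e)) ≈ₚ (σ ⟨$⟩ʳ s′ e , σ ⟨$⟩ʳ t′ e)) →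
    Singular (L a s t) (Kept I w) (Kept J w) →
    Singular (L (a ∘ (π ⟨$⟩ʳ_)) s′ t′)
      (Kept (preimage (π ⟨$⟩ʳ_) I) w′) (Kept (preimage (π ⟨$⟩ʳ_) J) w′)
  L-isomorphic a s t s′ t′ π σ I J w w′ ends sing =
    L-relabel {s = s} {t} {σ = σ ⟨$⟩ʳ_} (proj₁ ∘ sign) (proj₁ ∘ proj₂ ∘ sign)
      (onto-⊎ (onto-permutation-∉ π I) (onto-permutation-≢ σ w′))
      (onto-⊎ (onto-permutation-∉ π J) (onto-permutation-≢ σ w′))
      (λ _ → CommutativeRing.refl R) (λ e {v} _ → proj₂ (proj₂ (sign e)) v)
      (L-rebase a s t I J w (σ ⟨$⟩ʳ w′) sing)
    where
    sign = λ e → ξ-reorient {s = s} {t} {s′} {t′} (permutation-injective σ) (ends e)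

-- Dodgson polynomials as submatrices of `L`

module _ {m : ℕ} where

  open CommutativeRing (polyCommutativeRing m) using (_≈_; 0#; 1#; -_)
  open SingularMatrices (polyCommutativeRing m)
  private
    module R = CommutativeRing (polyCommutativeRing m)
    module D = DeterminantProperties (polyCommutativeRing m)

  weights : Subset m → Fin m → Poly m
  weights K e = if does (e ∈? K) then 0# else var e

  constant-0 : constant {m} 0ℤ ≋ []
  constant-0 μ with does (Vec.≡-dec ℕ._≟_ (𝟘 {m}) μ)
  ... | true  = refl
  ... | false = refl

  module _ {n} {G : Graph (suc n) m} (c : Choice G) where

    private
      s = source (orientation c)
      t = target (orientation c)
      w = column c

    -- The condition Ψ c I J K ≈ 0 freed from the ordering of the indices and
    -- from the equality of cardinalities.
    Vanishing : (I J K : Subset m) → Set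
    Vanishing I J K = Singular (L (weights K) s t) (Kept I w) (Kept J w)

    incidence≈ξ : ∀ e v → constant (incidence (orientation c) e v) ≋ ξ s t e v
    incidence≈ξ e v with s e ≟ t e
    ... | yes eq rewrite eq = R.trans {constant 0ℤ} {[]} {δ v (t e) ++ - δ v (t e)}
            constant-0 (R.sym {δ v (t e) ++ - δ v (t e)} {[]} (R.-‿inverseʳ (δ v (t e))))
    ... | no s≢t with v ≟ s e | v ≟ t e
    ...   | yes refl | yes eq = contradiction eq s≢t
    ...   | yes _      | no  _  = λ μ → refl
    ...   | no  _      | yes _  = λ μ → refl
    ...   | no  _      | no  _  = constant-0

    private
      φ : Fin m ⊎ Fin n → Fin m ⊎ Fin (suc n)
      φ = Sum.map id (punchIn w)

    bigMatrix≈L : ∀ K x y → bigMatrix c K x y ≋ L (weights K) s t (φ x) (φ y)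
    bigMatrix≈L K (inj₁ e) (inj₁ f) = λ μ → refl
    bigMatrix≈L K (inj₁ e) (inj₂ v) = incidence≈ξ e (punchIn w v)
    bigMatrix≈L K (inj₂ v) (inj₁ e) = R.-‿cong {ξ̂ c e v} {ξ s t e (punchIn w v)} (incidence≈ξ e (punchIn w v))
    bigMatrix≈L K (inj₂ v) (inj₂ u) = λ μ → refl

    enumerates-remaining : ∀ I → Enumerates (φ ∘ remaining I) (Kept I w)
    enumerates-remaining I =
      enumerates-image (onto-⊎ onto-id (onto-punchIn w)) (enumerates-⊎ (enumerates-∁ I) enumerates-id)

    module _ (I J K : Subset m) (eq : ∣ I ∣ ≡ ∣ J ∣) where

      private
        columns : ∀ {k l} .(eq : k ≡ l) {r : Fin l → Fin m ⊎ Fin (suc n)} {P : _ → Set} →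
          Enumerates r P → Enumerates (r ∘ cast eq) P
        columns eq = enumerates-∘-permutation (Perm.cast-id eq)

        Ψ≈det : Ψ c I J K eq ≋ D.det λ i j → L (weights K) s t (φ (remaining I i))
          (φ (remaining J (cast (cong (ℕ._+ n) (∣∁∣-cong I J eq)) j)))
        Ψ≈det = D.det-cong λ i j → bigMatrix≈L K (remaining I i) (remaining J (cast _ j))

      Ψ≈0⇒vanishing : Ψ c I J K eq ≋ [] → Vanishing I J K
      Ψ≈0⇒vanishing Ψ≈0 = singular-from (enumerates-remaining I) (columns _ (enumerates-remaining J))
        λ μ → trans (sym (Ψ≈det μ)) (Ψ≈0 μ)

      vanishing⇒Ψ≈0 : Vanishing I J K → Ψ c I J K eq ≋ []
      vanishing⇒Ψ≈0 sing μ = trans (Ψ≈det μ)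
        (vanishes sing (enumerates-remaining I) (columns _ (enumerates-remaining J)) μ)

-- Transfer of singularity between polynomial rings

Φ-if : ∀ {m m′} (f : MonomialMap m m′) {b b′ : Bool} {p : Poly m} {q : Poly m′} → b ≡ b′ →
  Substitution.Φ f p ≡ q → Substitution.Φ f (if b then [] else p) ≡ (if b′ then [] else q)
Φ-if f {true}  refl eq = refl
Φ-if f {false} refl eq = eq

module _ {m m′} (f : MonomialMap m m′) where
  open Substitution f
  private
    module S  = SingularMatrices (polyCommutativeRing m)
    module S′ = SingularMatrices (polyCommutativeRing m′)
    module R  = RawRing (polyRing m)
    module R′ = RawRing (polyRing m′)

  Φ-ξ : ∀ {k n} (s t : Fin k → Fin n) e v → Φ (S.ξ s t e v) ≡ S′.ξ s t e v
  Φ-ξ s t e v = trans (Φ-++ (S.δ v (s e)) (R.- S.δ v (t e)))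
    (cong₂ _++_ (Φ-δ v (s e)) (trans (Φ-neg (S.δ v (t e))) (cong R′.-_ (Φ-δ v (t e)))))
    where
    Φ-δ : ∀ i j → Φ (S.δ i j) ≡ S′.δ i j
    Φ-δ i j with does (i ≟ j)
    ... | true  = Φ-constant 1ℤ
    ... | false = refl

  -- Weights are compared only when both labels are the edge in question. This admits every entry
  -- but the corner in `L-peel`, where the variable lies outside the image of `Φ`.
  Φ-L : ∀ {k n} {a : Fin k → Poly m} {a′ : Fin k → Poly m′} (s t : Fin k → Fin n) x y →
    (∀ e → x ≡ inj₁ e → y ≡ inj₁ e → a′ e ≡ Φ (a e)) → S′.L a′ s t x y ≡ Φ (S.L a s t x y)
  Φ-L s t (inj₁ e) (inj₁ g) a≡ with e ≟ g
  ... | yes refl = a≡ e refl refl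
  ... | no  _      = refl
  Φ-L s t (inj₁ e) (inj₂ v) a≡ = sym (Φ-ξ s t e v)
  Φ-L s t (inj₂ v) (inj₁ e) a≡ = sym (trans (Φ-neg (S.ξ s t e v)) (cong R′.-_ (Φ-ξ s t e v)))
  Φ-L s t (inj₂ v) (inj₂ w) a≡ = refl

  Φ-singular : ∀ {X Y : Set} {M : X → Y → Poly m} {M′ : X → Y → Poly m′} {P Q} →
    (∀ x y → M′ x y ≡ Φ (M x y)) → S′.Singular M′ P Q → S.Singular M P Q
  Φ-singular {M = M} {M′} M≡ sing = S.singular λ {k} {r} {s} R S →
    Φ-injective₀ (D.det λ i j → M (r i) (s j)) λ μ →
    trans (cong (λ p → coeff p μ) (Φ-det λ i j → M (r i) (s j)))
      (trans (D′.det-cong {M = λ i j → Φ (M (r i) (s j))} {λ i j → M′ (r i) (s j)}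
                 (λ i j → ≡⇒≋ (sym (M≡ (r i) (s j)))) μ)
               (S′.vanishes sing R S μ))
    where module D  = DeterminantProperties (polyCommutativeRing m)
          module D′ = DeterminantProperties (polyCommutativeRing m′)

module _ {m} (e : Fin (suc m)) where
  open Peeling e
  private
    module S  = SingularMatrices (polyCommutativeRing m)
    module S′ = SingularMatrices (polyCommutativeRing (suc m))

  -- Listing `e` first among rows and columns puts its variable in the corner, as `det-peel`
  -- requires. The first conclusion serves deletion; the second, which retains row and column `e`,
  -- serves contraction.
  L-peel : ∀ {n} {a : Fin (suc m) → Poly (suc m)} {b : Fin (suc m) → Poly m} {s t : Fin (suc m) → Fin n} {P Q} →
    a e ≡ var e → b e ≡ [] → (∀ f → f ≢ e → a f ≡ Φ (b f)) → P (inj₁ e) → Q (inj₁ e) →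
    S′.Singular (S′.L a s t) P Q →
    S.Singular (S.L b s t) (P - inj₁ e) (Q - inj₁ e) × S.Singular (S.L b s t) P Q
  L-peel {n} {a} {b} {s} {t} {P} {Q} aₑ bₑ a≡ Pe Qe sing =
    S.singular (λ R S → proj₁ (peel R S)) , S.singular whole
    where
    module D = DeterminantProperties (polyCommutativeRing m)
    peel : ∀ {k} {ρ σ : Fin k → Fin (suc m) ⊎ Fin n} → Enumerates ρ (P - inj₁ e) → Enumerates σ (Q - inj₁ e) →
      D.det (λ i j → S.L b s t (ρ i) (σ j)) ≋ [] ×
      D.det (λ i j → S.L b s t ((inj₁ e F.∷ ρ) i) ((inj₁ e F.∷ σ) j)) ≋ []
    peel {ρ = ρ} {σ} R S = det-peel (λ i j → S′.L a s t (ρ⁺ i) (σ⁺ j)) (λ i j → S.L b s t (ρ⁺ i) (σ⁺ j))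
      (≡⇒≋ (trans (S′.L-diagonal a s t e) aₑ))
      (≡⇒≋ (trans (S.L-diagonal b s t e) bₑ))
      (λ j → ≡⇒≋ (Φ-L (insertion e) s t (inj₁ e) (σ j) λ { f refl eq → contradiction eq (proj₂ (sound S j)) }))
      (λ i c → ≡⇒≋ (Φ-L (insertion e) s t (ρ i) (σ⁺ c) λ f eq _ →
        a≡ f λ { refl → proj₂ (sound R i) eq }))
      (S′.vanishes sing (enumerates-cons Pe (inj₁-≟ e) R) (enumerates-cons Qe (inj₁-≟ e) S))
      where
      ρ⁺ = inj₁ e F.∷ ρ
      σ⁺ = inj₁ e F.∷ σ
    -- Arbitrary enumerations of `P` and `Q` need not begin with `e`; they are compared with ones
    -- that do.
    whole : ∀ {k} {r s′ : Fin k → Fin (suc m) ⊎ Fin n} → Enumerates r P → Enumerates s′ Q →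
      D.det (λ i j → S.L b s t (r i) (s′ j)) ≋ []
    whole R S with enumerates-without R Pe | enumerates-without S Qe
    ... | k , ρ , refl , R⁻ | .k , σ , refl , S⁻ =
      S.vanishes (S.singular-from {M = S.L b s t}
        (enumerates-cons Pe (inj₁-≟ e) R⁻) (enumerates-cons Qe (inj₁-≟ e) S⁻)
        (proj₂ (peel R⁻ S⁻))) R S

  -- The weights of G after setting α_e = 0, over the variables of G ∖ e.
  weights⁻ : Subset (suc m) → Fin (suc m) → Poly m
  weights⁻ K f with e ≟ f
  ... | yes _   = []
  ... | no  e≢f = weights (preimage (punchIn e) K) (punchOut e≢f)

  weights⁻-self : ∀ K → weights⁻ K e ≡ []
  weights⁻-self K with e ≟ e
  ... | yes _   = refl
  ... | no  e≢e = contradiction refl e≢e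

  weights⁻-punchIn : ∀ K f → weights⁻ K (punchIn e f) ≡ weights (preimage (punchIn e) K) f
  weights⁻-punchIn K f with e ≟ punchIn e f
  ... | yes eq = contradiction (sym eq) (punchInᵢ≢i e f)
  ... | no  e≢ = cong (weights (preimage (punchIn e) K))
    (trans (punchOut-cong e refl) (punchOut-punchIn e))

  weights≡Φ : ∀ K f → f ≢ e → weights K f ≡ Φ (weights⁻ K f)
  weights≡Φ K f f≢e with e ≟ f
  ... | yes e≡f = contradiction (sym e≡f) f≢e
  ... | no  e≢f = sym (Φ-if (insertion e)
    (trans (does-∈-preimage {ι = punchIn e} {K} (punchOut e≢f))
      (cong (λ g → does (g ∈? K)) (punchIn-punchOut e≢f)))
    (trans (Φ-var-punchIn (punchOut e≢f)) (cong var (punchIn-punchOut e≢f))))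

  weights-∉ : ∀ {K} → e ∉ K → weights K e ≡ var e
  weights-∉ {K} e∉K = cong (if_then [] else var e) (dec-false (e ∈? K) e∉K)

-- Vanishing passes to minors and isomorphic graphs

module _ {n m} {G : Graph (suc n) (suc m)} (e : Fin (suc m)) where

  delete-choice : Choice G → Choice (G ∖ e)
  delete-choice c = record
    { orientation = record
      { source  = source (orientation c) ∘ punchIn e
      ; target  = target (orientation c) ∘ punchIn e
      ; orients = orients (orientation c) ∘ punchIn e
      }
    ; column = column c
    }

  delete-vanishing : (c : Choice G) {I J K : Subset (suc m)} → e ∉ I → e ∉ J → e ∉ K →
    Vanishing c I J K →
    Vanishing (delete-choice c) (preimage (punchIn e) I) (preimage (punchIn e) J) (preimage (punchIn e) K)
  delete-vanishing c {I} {J} {K} e∉I e∉J e∉K sing =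
    L-delete e I J (λ f → sym (weights⁻-punchIn e K f))
      (proj₁ (L-peel e {P = Kept I (column c)} {Kept J (column c)}
        (weights-∉ e e∉K) (weights⁻-self e K) (weights≡Φ e K) e∉I e∉J sing))
    where open MinorMatrices (polyCommutativeRing m)

module _ {n m} {G : Graph (suc (suc n)) (suc m)} (e : Fin (suc m)) (link : IsLink G e) where

  private
    u = proj₁ (ends G e)
    v = proj₂ (ends G e)
    q = identify u v link

  -- The merged vertex is the column to delete, since at all other vertices the incidence entries
  -- are those of `G`.
  contract-choice : Choice G → Choice (contract G e link)
  contract-choice c = record
    { orientation = record
      { source  = q ∘ source (orientation c) ∘ punchIn e
      ; target  = q ∘ target (orientation c) ∘ punchIn e
      ; orients = λ f → ≈ₚ-map q (orients (orientation c) (punchIn e f))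
      }
    ; column = q u
    }

  contract-vanishing : (c : Choice G) {I J K : Subset (suc m)} → e ∉ I → e ∉ J → e ∉ K →
    Vanishing c I J K →
    Vanishing (contract-choice c) (preimage (punchIn e) I) (preimage (punchIn e) J) (preimage (punchIn e) K)
  contract-vanishing c {I} {J} {K} e∉I e∉J e∉K sing =
    L-contract link e I J (orients (orientation c) e) e∉I e∉J (≡⇒≋ (weights⁻-self e K))
      (λ f → sym (weights⁻-punchIn e K f))
      (proj₂ (L-peel e {P = Kept I (column c)} {Kept J (column c)}
        (weights-∉ e e∉K) (weights⁻-self e K) (weights≡Φ e K) e∉I e∉J sing))
    where open MinorMatrices (polyCommutativeRing m)

module _ {n m} {G H : Graph (suc n) m} (iso : H ≅ G) where
  open _≅_ iso

  private
    π = onEdges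
    σ = onVertices

  -- The two graphs name the same variables differently. Renaming along `π` turns the weights of `H`
  -- into those of `G` composed with `π`, and being injective it reflects vanishing.
  ≅-vanishing : (c : Choice G) (d : Choice H) {I J K : Subset m} → Vanishing c I J K →
    Vanishing d (preimage (π ⟨$⟩ʳ_) I) (preimage (π ⟨$⟩ʳ_) J) (preimage (π ⟨$⟩ʳ_) K)
  ≅-vanishing c d {I} {J} {K} sing =
    Φ-singular (relabelling π)
      (λ x y → Φ-L (relabelling π) (source (orientation d)) (target (orientation d)) x y λ e _ _ →
        sym (Φ-if (relabelling π) (does-∈-preimage {p = K} e) (Φ-var-relabelling π e)))
      (L-isomorphic (weights K) (source (orientation c)) (target (orientation c)) _ _ π σ
        I J (column c) (column d)
        (λ e → ≈ₚ-trans (orients (orientation c) (π ⟨$⟩ʳ e))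
          (≈ₚ-trans (onEnds e) (≈ₚ-sym (≈ₚ-map (σ ⟨$⟩ʳ_) (orients (orientation d) e))))) sing)
    where open MinorMatrices (polyCommutativeRing m)

-- Pulling Dodgson indices back along an injection of edges

image : ∀ {m M} → (Fin m → Fin M) → Subset m → Subset M
image ι S = tabulate λ j → does (any? λ i → (ι i ≟ j) ×-dec (i ∈? S))

module _ {m M} {ι : Fin m → Fin M} where

  ∈-image⁺ : ∀ {S i} → i ∈ S → ι i ∈ image ι S
  ∈-image⁺ {S} {i} i∈S = Vec.lookup⇒[]= (ι i) (image ι S) (trans (Vec.lookup∘tabulate _ (ι i))
    (dec-true (any? λ i′ → (ι i′ ≟ ι i) ×-dec (i′ ∈? S)) (i , refl , i∈S)))

  ∈-image⁻ : ∀ {S j} → j ∈ image ι S → ∃ λ i → i ∈ S × ι i ≡ j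
  ∈-image⁻ {S} {j} j∈ with any? (λ i → (ι i ≟ j) ×-dec (i ∈? S))
                         | trans (sym (Vec.lookup∘tabulate _ j)) (Vec.[]=⇒lookup j∈)
  ... | yes (i , eq , i∈S) | _ = i , i∈S , eq
  ... | no _               | ()

  preimage-zipWith : (f : Bool → Bool → Bool) (p q : Subset M) →
    preimage ι (zipWith f p q) ≡ zipWith f (preimage ι p) (preimage ι q)
  preimage-zipWith f p q = trans
    (Vec.tabulate-cong λ i → trans (Vec.lookup-zipWith f (ι i) p q)
      (trans (sym (cong₂ f (Vec.lookup∘tabulate (lookup p ∘ ι) i) (Vec.lookup∘tabulate (lookup q ∘ ι) i)))
             (sym (Vec.lookup-zipWith f i (preimage ι p) (preimage ι q)))))
    (Vec.tabulate∘lookup _)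

  preimage-⊥ : preimage ι ⊥ ≡ ⊥
  preimage-⊥ = trans (Vec.tabulate-cong λ i →
    trans (Vec.lookup-replicate (ι i) _) (sym (Vec.lookup-replicate i _))) (Vec.tabulate∘lookup ⊥)

  module _ (ι-injective : Injective _≡_ _≡_ ι) where

    preimage-image : ∀ S → preimage ι (image ι S) ≡ S
    preimage-image S = ⊆-antisym
      (λ x∈ → let i , i∈S , eq = ∈-image⁻ (∈-preimage⁻ x∈) in subst (_∈ S) (ι-injective eq) i∈S)
      (∈-preimage⁺ ∘ ∈-image⁺)

    ∣∣-onto : ∀ {p q} → Onto ι (_∈ p) (_∈ q) → ∣ q ∣ ≡ ∣ p ∣
    ∣∣-onto {p} {q} O = enumerates-size (enumerates-enumerate q) (enumerates-image O (enumerates-enumerate p))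

    ∣image∣ : ∀ S → ∣ image ι S ∣ ≡ ∣ S ∣
    ∣image∣ S = ∣∣-onto record { φ-injective = ι-injective ; into = ∈-image⁺ ; onto = ∈-image⁻ }

    ∣preimage∣ : ∀ {S p} → p ⊆ image ι S → ∣ preimage ι p ∣ ≡ ∣ p ∣
    ∣preimage∣ {S} {p} p⊆ = sym (∣∣-onto record
      { φ-injective = ι-injective
      ; into        = ∈-preimage⁻
      ; onto        = λ x∈p → let i , _ , eq = ∈-image⁻ (p⊆ x∈p) in
                        i , ∈-preimage⁺ (subst (_∈ p) (sym eq) x∈p) , eq
      })

    -- Preimages commute with the Boolean operations, and cardinalities are preserved because
    -- `covers` confines `I`, `J` and `K` to the image of `S`.
    preimage-index : ∀ {S} → DodgsonIndex (image ι S) → DodgsonIndex S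
    preimage-index {S} d = record
      { I        = preimage ι I
      ; J        = preimage ι J
      ; K        = preimage ι K
      ; covers   = trans (sym (trans (preimage-∪ I (J ∪ K)) (cong (preimage ι I ∪_) (preimage-∪ J K))))
                     (trans (cong (preimage ι) covers) (preimage-image S))
      ; disjoint = trans (cong (preimage ι K ∩_) (sym (preimage-∪ I J)))
                     (trans (sym (preimage-∩ K (I ∪ J))) (trans (cong (preimage ι) disjoint) preimage-⊥))
      ; shape    = shape′ shape
      }
      where
      open DodgsonIndex d
      preimage-∪ = preimage-zipWith _∨_
      preimage-∩ = preimage-zipWith _∧_
      I⊆ : I ⊆ image ι S
      I⊆ = subst (_ ∈_) covers ∘ p⊆p∪q _
      J⊆ : J ⊆ image ι S
      J⊆ = subst (_ ∈_) covers ∘ q⊆p∪q I _ ∘ p⊆p∪q _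
      K⊆ : K ⊆ image ι S
      K⊆ = subst (_ ∈_) covers ∘ q⊆p∪q I _ ∘ q⊆p∪q J _
      shape′ : _ → _
      shape′ (inj₁ (i , j , i∩j , k)) = inj₁
        ( trans (∣preimage∣ I⊆) i , trans (∣preimage∣ J⊆) j
        , trans (sym (preimage-∩ I J)) (trans (cong (preimage ι) i∩j) preimage-⊥)
        , trans (∣preimage∣ K⊆) k)
      shape′ (inj₂ (i , j , i∩j , k)) = inj₂
        ( trans (∣preimage∣ I⊆) i , trans (∣preimage∣ J⊆) j
        , trans (cong ∣_∣ (sym (preimage-∩ I J))) (trans (∣preimage∣ (I⊆ ∘ p∩q⊆p I J)) i∩j)
        , trans (cong (preimage ι) k) preimage-⊥)

-- Splitting passes to minors

_⊆range_ : ∀ {m M} → Subset M → (Fin m → Fin M) → Set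
p ⊆range ι = ∀ {x} → x ∈ p → ∃ λ i → ι i ≡ x

module _ {n m n′ m′} {G : Graph (suc n) m} {H : Graph (suc n′) m′} (c : Choice G) (d : Choice H)
  {ι : Fin m′ → Fin m} (ι-injective : Injective _≡_ _≡_ ι)
  (vanishing : ∀ {I J K} → I ⊆range ι → J ⊆range ι → K ⊆range ι →
    Vanishing c I J K → Vanishing d (preimage ι I) (preimage ι J) (preimage ι K)) where

  -- A configuration of `H` is pushed forward to `G`, and the index found there is pulled back. That
  -- index lies in the range of `ι`, so for `punchIn e` it avoids the edge removed.
  splits-transfer : Splits c → Splits d
  splits-transfer splits S ∣S∣≡5 with splits (image ι S) (trans (∣image∣ ι-injective S) ∣S∣≡5)
  ... | i , Ψ≈0 = preimage-index ι-injective i ,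
    vanishing⇒Ψ≈0 d _ _ _ (DodgsonIndex.∣I∣≡∣J∣ (preimage-index ι-injective i))
      (vanishing (inRange (p⊆p∪q _)) (inRange (q⊆p∪q I _ ∘ p⊆p∪q _)) (inRange (q⊆p∪q I _ ∘ q⊆p∪q J _))
        (Ψ≈0⇒vanishing c I J K ∣I∣≡∣J∣ Ψ≈0))
    where
    open DodgsonIndex i
    inRange : ∀ {p} → p ⊆ I ∪ J ∪ K → p ⊆range ι
    inRange p⊆ x∈p = let i , _ , eq = ∈-image⁻ (subst (_ ∈_) covers (p⊆ x∈p)) in i , eq

∉-range : ∀ {m} {e : Fin (suc m)} {p} → p ⊆range punchIn e → e ∉ p
∉-range {e = e} p⊆ e∈p = let i , eq = p⊆ e∈p in punchInᵢ≢i e i eq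

delete-splits : ∀ {n m} {G : Graph (suc n) (suc m)} (e : Fin (suc m)) (c : Choice G) →
  Splits c → Splits (delete-choice e c)
delete-splits e c = splits-transfer c (delete-choice e c) (punchIn-injective e _ _)
  λ I J K → delete-vanishing e c (∉-range I) (∉-range J) (∉-range K)

contract-splits : ∀ {n m} {G : Graph (suc (suc n)) (suc m)} (e : Fin (suc m)) (link : IsLink G e)
  (c : Choice G) → Splits c → Splits (contract-choice e link c)
contract-splits e link c = splits-transfer c (contract-choice e link c) (punchIn-injective e _ _)
  λ I J K → contract-vanishing e link c (∉-range I) (∉-range J) (∉-range K)

≅-splits : ∀ {n m} {G H : Graph (suc n) m} → H ≅ G → (c : Choice G) (d : Choice H) → Splits c → Splits d
≅-splits iso c d = splits-transfer c d (permutation-injective (_≅_.onEdges iso))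
  λ _ _ _ → ≅-vanishing iso c d

-- Each deletion or contraction comes with a choice derived from `c`; the arbitrary `cₘ` is met only
-- at the final isomorphism, where any two choices may be compared.
theorem11 : ∀ {n m n′ m′ : ℕ} (G : Graph (suc n) m) (Gₘ : Graph (suc n′) m′) →
    Gₘ ≼ G →
    (c : Choice G) (cₘ : Choice Gₘ) →
    Splits c → Splits cₘ
theorem11 G Gₘ (done iso) c cₘ splits = ≅-splits iso c cₘ splits
theorem11 G Gₘ (delete e Gₘ≼) c cₘ splits =
  theorem11 (G ∖ e) Gₘ Gₘ≼ (delete-choice e c) cₘ (delete-splits e c splits)
theorem11 G Gₘ (contract-loop e _ Gₘ≼) c cₘ splits =
  theorem11 (G ∖ e) Gₘ Gₘ≼ (delete-choice e c) cₘ (delete-splits e c splits)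
-- A graph with one vertex has no link. The case stands apart because `contract-choice` needs a
-- vertex to remain after contraction.
theorem11 {zero} G Gₘ (contract-link e link _) c cₘ splits
  with proj₁ (ends G e) | proj₂ (ends G e) | link
... | zero | zero | 0≢0 = contradiction refl 0≢0
theorem11 {suc n} G Gₘ (contract-link e link Gₘ≼) c cₘ splits =
  theorem11 (contract G e link) Gₘ Gₘ≼ (contract-choice e link c) cₘ (contract-splits e link c splits)
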